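{- For every integer $g\ge 0$, every graph with Euler genus $g$ admits layered separations of width $2g+3$.
   Context: Graphs are finite, simple and undirected. The Euler genus of a surface $\Sigma$ is $2-\chi(\Sigma)$, where $\chi$ is the Euler characteristic; the Euler genus of a graph is the minimum Euler genus of a surface in which it embeds. A layering of a graph $G$ is a partition $(V_0,V_1,\dots,V_t)$ of $V(G)$ such that for every edge $vw\in E(G)$, if $v\in V_i$ and $w\in V_j$ then $|i-j|\le 1$. Each $V_i$ is a layer. A separation of $G$ is a pair $(G_1,G_2)$ of subgraphs of $G$ with $G=G_1\cup G_2$. $G$ admits layered separations of width $\ell$ with respect to a layering $(V_0,\dots,V_t)$ if for every $S\subseteq V(G)$ there is a separation $(G_1,G_2)$ of $G$ such that each layer $V_i$ contains at most $\ell$ vertices of $V(G_1\cap G_2)$, and both $V(G_1)\setminus V(G_2)$ and $V(G_2)\setminus V(G_1)$ contain at most $\frac23|S|$ vertices of $S$. $G$ admits layered separations of width $\ell$ if it does so with respect to some layering of $G$. -}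

module Defs where

open import Level using (0ℓ)
open import Data.Nat.Base using (ℕ; suc; _*_; _≤_; ∣_-_∣)
import Data.Integer.Base as ℤ
open ℤ using (ℤ; +_)
open import Data.Fin.Base using (Fin; toℕ)
open import Data.Fin.Patterns using (0F; 1F; 2F)
open import Data.Fin.Properties using (_≟_)
open import Data.Fin.Subset using (Subset; _∈_; _∩_; _─_; ∣_∣)
open import Data.Vec.Base using (tabulate)
open import Data.Product.Base using (Σ-syntax; ∃-syntax; _×_)
open import Data.Sum.Base using (_⊎_)
open import Function.Bundles using (_⇔_)
open import Function.Definitions using (Injective; StrictlySurjective)
open import Relation.Binary.Core using (Rel)
open import Relation.Binary.Definitions using (Symmetric; Irreflexive; Decidable)
open import Relation.Binary.Construct.Closure.ReflexiveTransitive using (Star)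
open import Relation.Binary.PropositionalEquality.Core using (_≡_; _≢_)
open import Relation.Nullary.Decidable using (⌊_⌋)

record Graph : Set₁ where
  field
    order   : ℕ
  Vertex : Set
  Vertex = Fin order
  field
    _~_     : Rel Vertex 0ℓ
    _~?_    : Decidable _~_
    ~-sym   : Symmetric _~_
    ~-irrefl : Irreflexive _≡_ _~_

record Subgraph (G : Graph) : Set₁ where
  open Graph G
  field
    V       : Subset order
    E       : Rel Vertex 0ℓ
    E?      : Decidable E
    E-sym   : Symmetric E
    E⊆~     : ∀ {u v} → E u v → u ~ v
    E-ends  : ∀ {u v} → E u v → u ∈ V

-- A compact connected surface without boundary, orientable or not, presented
-- by a cell decomposition.  A flag is an edge with a chosen end and a chosen
-- side, i.e. a triangle of the barycentric subdivision; τ i leads to the flag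
-- across the side of that triangle opposite the barycentre of its i-cell.
-- The i-cells are therefore the orbits of the group generated by the τ j with
-- j ≢ i.  The 1-skeleton is a multigraph: loops and parallel edges may occur.
record Surface : Set where
  field
    #flags : ℕ
  Flag : Set
  Flag = Fin #flags
  field
    τ            : Fin 3 → Flag → Flag
    τ-involutive : ∀ i x → τ i (τ i x) ≡ x
    τ-free       : ∀ i x → τ i x ≢ x
    τ₀τ₂-comm    : ∀ x → τ 0F (τ 2F x) ≡ τ 2F (τ 0F x)
    τ₀τ₂-free    : ∀ x → τ 0F (τ 2F x) ≢ x
    inhabited    : Flag
    connected    : ∀ x y → Star (λ p q → ∃[ j ] q ≡ τ j p) x y

  SameCell : Fin 3 → Rel Flag 0ℓ
  SameCell i = Star (λ p q → ∃[ j ] (j ≢ i × q ≡ τ j p))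

  -- An enumeration without repetition of the i-cells, for each i.
  field
    #cells    : Fin 3 → ℕ
    cell      : ∀ i → Flag → Fin (#cells i)
    cell-onto : ∀ i → StrictlySurjective _≡_ (cell i)
    cell-≡    : ∀ i x y → cell i x ≡ cell i y ⇔ SameCell i x y

  χ : ℤ
  χ = + #cells 0F ℤ.- + #cells 1F ℤ.+ + #cells 2F

  eulerGenus : ℤ
  eulerGenus = + 2 ℤ.- χ

-- G is drawn inside the 1-skeleton of the cell decomposition, which may have
-- further vertices and edges; so faces of the drawing of G need not be discs,
-- and G need not be connected.  As G is simple and vertices are mapped
-- injectively, distinct edges of G receive distinct 1-cells.
record _EmbedsIn_ (G : Graph) (M : Surface) : Set where
  open Graph G
  open Surface M
  field
    vertex           : Vertex → Fin (#cells 0F)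
    vertex-injective : Injective _≡_ _≡_ vertex
    edge             : ∀ {u v} → u ~ v →
                       ∃[ x ] (cell 0F x ≡ vertex u × cell 0F (τ 0F x) ≡ vertex v)

HasEulerGenus : Graph → ℕ → Set
HasEulerGenus G g =
  (∃[ M ] (G EmbedsIn M × Surface.eulerGenus M ≡ + g)) ×
  (∀ M → G EmbedsIn M → + g ℤ.≤ Surface.eulerGenus M)

record Layering (G : Graph) : Set where
  open Graph G
  field
    t       : ℕ
    layerOf : Vertex → Fin (suc t)
    close   : ∀ {v w} → v ~ w → ∣ toℕ (layerOf v) - toℕ (layerOf w) ∣ ≤ 1

  layer : Fin (suc t) → Subset order
  layer i = tabulate (λ v → ⌊ layerOf v ≟ i ⌋)

record Separation (G : Graph) : Set₁ where
  open Graph G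
  field
    G₁ G₂ : Subgraph G
  open Subgraph G₁ public using () renaming (V to V₁; E to E₁)
  open Subgraph G₂ public using () renaming (V to V₂; E to E₂)
  field
    V-cover : ∀ v → v ∈ V₁ ⊎ v ∈ V₂
    E-cover : ∀ {u v} → u ~ v → E₁ u v ⊎ E₂ u v

AdmitsLayeredSeparationsWrt : (G : Graph) → Layering G → ℕ → Set₁
AdmitsLayeredSeparationsWrt G L ℓ =
  (S : Subset order) → Σ[ sep ∈ Separation G ] let open Separation sep in
    (∀ i → ∣ layer i ∩ (V₁ ∩ V₂) ∣ ≤ ℓ) ×
    3 * ∣ (V₁ ─ V₂) ∩ S ∣ ≤ 2 * ∣ S ∣ ×
    3 * ∣ (V₂ ─ V₁) ∩ S ∣ ≤ 2 * ∣ S ∣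
  where
  open Graph G
  open Layering L

AdmitsLayeredSeparations : Graph → ℕ → Set₁
AdmitsLayeredSeparations G ℓ = Σ[ L ∈ Layering G ] AdmitsLayeredSeparationsWrt G L ℓ

{-# OPTIONS --safe #-}
module Submission where

-- Regard the flags of M as the triangles of its barycentric subdivision.  A
-- breadth-first tree of the 1-skeleton gives the layers; hang the edge and face
-- barycentres on it to obtain a spanning tree of the subdivision.  The triangles
-- are still connected across the sides outside this tree, so they carry a dual
-- spanning tree, and by Euler's formula g sides lie in neither tree.  A set of
-- triangles bounded by tree sides and by some other sides can have both kinds
-- of triangles around a vertex v only if v lies on the tree path from an end of
-- one of these other sides to the root: an innermost tree side on the boundary
-- would make the set change exactly once around one of its ends.  Hence
-- deleting the 2 g paths from the ends of the extra sides and the 3 paths from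
-- the corners of a triangle f separates the up to three parts into which f
-- splits the dual tree.  Take f to be a deepest triangle below which lies at
-- least half of S: each part then has at most half of S, and the heaviest part
-- against the rest is the separation.  A path to the root has one vertex per layer.

open import Defs
open import Data.Bool.Base using (Bool; true; false; if_then_else_; T)
open import Data.Bool.Properties using (T?)
open import Data.Empty using (⊥; ⊥-elim)
open import Data.Fin.Base using (Fin; zero; suc; toℕ; fromℕ<)
open import Data.Fin.Patterns using (0F; 1F; 2F)
open import Data.Fin.Permutation using (permutation)
import Data.Fin.Properties as Fin
open import Data.Fin.Properties using (_≟_; any?; all?)
open import Data.Fin.Subset using (Subset; inside; outside; _∈_; _∉_; _∩_; _─_; ∣_∣)
open import Data.Fin.Subset.Properties using (_∈?_; x∈p∩q⁻; p─q⊆p)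
import Data.Integer.Base as ℤ
import Data.Integer.Properties as ℤ
import Data.Integer.Tactic.RingSolver as ℤ-Solver
open import Data.Nat.Base using (ℕ; zero; suc; _+_; _*_; _∸_; _≤_; _<_; z≤n; s≤s; s≤s⁻¹; ∣_-_∣)
open import Data.Nat.Properties hiding (_≟_)
open import Data.Nat.Tactic.RingSolver using (solve-∀)
open import Data.Product.Base using (∃-syntax; _×_; _,_; proj₁; proj₂)
open import Data.Sum.Base using (_⊎_; inj₁; inj₂)
open import Data.Unit.Base using (tt)
open import Data.Vec.Base using ([]; _∷_; here; there; tabulate; lookup)
open import Data.Vec.Properties using (lookup∘tabulate; lookup⇒[]=; []=⇒lookup)
open import Function.Base using (_∘_)
open import Function.Bundles using (Equivalence)
open import Relation.Binary.Construct.Closure.ReflexiveTransitive using (Star; ε; _◅_)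
open import Relation.Binary.Definitions using (tri<; tri≈; tri>)
open import Relation.Binary.PropositionalEquality
open import Relation.Nullary using (¬_; Dec; yes; no; does; contradiction)
open import Relation.Nullary.Decidable using (_×-dec_; _⊎-dec_; ¬?; ⌊_⌋; isYes≗does)
open import Algebra.Properties.CommutativeMonoid.Sum +-0-commutativeMonoid
  using (sum; sum-cong-≗; ∑-distrib-+; ∑-comm; sum-permute; sum-replicate-zero)

-- Indicators and finite sums

private variable
  P Q R : Set
  n : ℕ

𝟙 : Dec P → ℕ
𝟙 p = if does p then 1 else 0

if-yes : {A : Set} {a b : A} (p : Dec P) → P → (if does p then a else b) ≡ a
if-yes (yes _) _ = refl
if-yes (no ¬p) p = contradiction p ¬p

if-no : {A : Set} {a b : A} (p : Dec P) → ¬ P → (if does p then a else b) ≡ b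
if-no (yes p) ¬p = contradiction p ¬p
if-no (no _)  _  = refl

𝟙-yes : (p : Dec P) → P → 𝟙 p ≡ 1
𝟙-yes = if-yes

𝟙-no : (p : Dec P) → ¬ P → 𝟙 p ≡ 0
𝟙-no = if-no

𝟙≤1 : (p : Dec P) → 𝟙 p ≤ 1
𝟙≤1 (yes _) = ≤-refl
𝟙≤1 (no _)  = z≤n

𝟙-mono : (p : Dec P) (q : Dec Q) → (P → Q) → 𝟙 p ≤ 𝟙 q
𝟙-mono (yes p) q f = ≤-reflexive (sym (𝟙-yes q (f p)))
𝟙-mono (no _)  q f = z≤n

𝟙-cong : (p : Dec P) (q : Dec Q) → (P → Q) → (Q → P) → 𝟙 p ≡ 𝟙 q
𝟙-cong p q f g = ≤-antisym (𝟙-mono p q f) (𝟙-mono q p g)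

𝟙-+ : (p : Dec P) (q : Dec Q) (r : Dec R) → (P → Q → ⊥) → (P → R) → (Q → R) → 𝟙 p + 𝟙 q ≤ 𝟙 r
𝟙-+ (yes p) q r e f g = subst₂ _≤_ (cong suc (sym (𝟙-no q (e p)))) (sym (𝟙-yes r (f p))) ≤-refl
𝟙-+ (no ¬p) q r e f g = 𝟙-mono q r g

does-cong : (p : Dec P) (q : Dec Q) → (P → Q) → (Q → P) → does p ≡ does q
does-cong (yes p) (yes q) f g = refl
does-cong (yes p) (no ¬q) f g = contradiction (f p) ¬q
does-cong (no ¬p) (yes q) f g = contradiction (g q) ¬p
does-cong (no ¬p) (no ¬q) f g = refl

does-transport : (p : Dec P) (q : Dec Q) → does p ≡ does q → P → Q
does-transport (yes _)  (yes q) _ _ = q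
does-transport (no ¬p) _       _ p = contradiction p ¬p

sum-mono-≤ : {f g : Fin n → ℕ} → (∀ i → f i ≤ g i) → sum f ≤ sum g
sum-mono-≤ {zero}  h = z≤n
sum-mono-≤ {suc n} h = +-mono-≤ (h zero) (sum-mono-≤ (h ∘ suc))

sum-mono-< : {f g : Fin n → ℕ} → (∀ i → f i ≤ g i) → ∀ j → f j < g j → sum f < sum g
sum-mono-< h zero    lt = +-mono-<-≤ lt (sum-mono-≤ (h ∘ suc))
sum-mono-< h (suc j) lt = +-mono-≤-< (h zero) (sum-mono-< (h ∘ suc) j lt)

term≤sum : (f : Fin n → ℕ) (i : Fin n) → f i ≤ sum f
term≤sum f zero    = m≤m+n _ _
term≤sum f (suc i) = ≤-trans (term≤sum (f ∘ suc) i) (m≤n+m _ (f zero))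

sum-const-1 : ∀ n → sum {n} (λ _ → 1) ≡ n
sum-const-1 zero    = refl
sum-const-1 (suc n) = cong suc (sum-const-1 n)

sum-≟ : (a : Fin n) → sum (λ x → 𝟙 (x ≟ a)) ≡ 1
sum-≟ {suc n} zero    = cong suc (sum-replicate-zero n)
sum-≟ {suc n} (suc a) = trans (sum-cong-≗ (λ x → 𝟙-cong (suc x ≟ suc a) (x ≟ a) Fin.suc-injective (cong suc))) (sum-≟ a)

sum-×≟ : (p : Dec P) (a : Fin n) → sum (λ x → 𝟙 (p ×-dec (x ≟ a))) ≡ 𝟙 p
sum-×≟         (yes _) a = sum-≟ a
sum-×≟ {n = n} (no _)  a = sum-replicate-zero n

sum-≢ : (a : Fin n) → sum (λ x → 𝟙 (¬? (x ≟ a))) + 1 ≡ n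
sum-≢ {n} a = begin
  sum (λ x → 𝟙 (¬? (x ≟ a))) + 1                           ≡⟨ cong (sum (λ x → 𝟙 (¬? (x ≟ a))) +_) (sum-≟ a) ⟨
  sum (λ x → 𝟙 (¬? (x ≟ a))) + sum (λ x → 𝟙 (x ≟ a))   ≡⟨ ∑-distrib-+ (λ x → 𝟙 (¬? (x ≟ a))) (λ x → 𝟙 (x ≟ a)) ⟨
  sum (λ x → 𝟙 (¬? (x ≟ a)) + 𝟙 (x ≟ a))                  ≡⟨ sum-cong-≗ (λ x → complement (x ≟ a)) ⟩
  sum {n} (λ _ → 1)                                         ≡⟨ sum-const-1 n ⟩
  n                                                         ∎
  where
  open ≡-Reasoning
  complement : (p : Dec P) → 𝟙 (¬? p) + 𝟙 p ≡ 1
  complement (yes _) = refl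
  complement (no _)  = refl

-- Both sides count the pairs of a class `c` satisfying `Q` and its representative: an `x` can occur
-- in such a pair only with its own class.
sum-section : ∀ {m} {Q : Fin m → Set} (Q? : ∀ c → Dec (Q c)) (class : Fin n → Fin m) (rep : Fin m → Fin n) →
              (∀ c → class (rep c) ≡ c) →
              sum (λ x → 𝟙 (Q? (class x) ×-dec (x ≟ rep (class x)))) ≡ sum (λ c → 𝟙 (Q? c))
sum-section {n} {m} {Q} Q? class rep sec = begin
  sum (λ x → 𝟙 (Q? (class x) ×-dec (x ≟ rep (class x))))      ≡⟨ sum-cong-≗ spread ⟩
  sum (λ x → sum (λ c → 𝟙 (Q? c ×-dec (x ≟ rep c))))          ≡⟨ ∑-comm (λ x c → 𝟙 (Q? c ×-dec (x ≟ rep c))) ⟩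
  sum (λ c → sum (λ x → 𝟙 (Q? c ×-dec (x ≟ rep c))))          ≡⟨ sum-cong-≗ (λ c → sum-×≟ (Q? c) (rep c)) ⟩
  sum (λ c → 𝟙 (Q? c))                                        ∎
  where
  open ≡-Reasoning
  spread : ∀ x → 𝟙 (Q? (class x) ×-dec (x ≟ rep (class x))) ≡ sum (λ c → 𝟙 (Q? c ×-dec (x ≟ rep c)))
  spread x = trans (sym (sum-×≟ (Q? (class x) ×-dec (x ≟ rep (class x))) (class x)))
    (sum-cong-≗ λ c → 𝟙-cong ((Q? (class x) ×-dec (x ≟ rep (class x))) ×-dec (c ≟ class x)) (Q? c ×-dec (x ≟ rep c))
      (λ { (h , refl) → h })
      (λ { (q , refl) → (subst Q (sym (sec c)) q , cong rep (sym (sec c))) , sym (sec c) }))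

argmax : ∀ {n} (f : Fin (suc n) → ℕ) → ∃[ j ] (∀ k → f k ≤ f j)
argmax {zero}  f = zero , λ { zero → ≤-refl }
argmax {suc n} f with argmax (f ∘ suc)
... | j , max with ≤-total (f zero) (f (suc j))
...   | inj₁ le = suc j , λ { zero → le ; (suc k) → max k }
...   | inj₂ ge = zero , λ { zero → ≤-refl ; (suc k) → ≤-trans (max k) ge }

sum-fibre≤1 : ∀ {m} (h : Fin n → Fin m) → (∀ {x y} → h x ≡ h y → x ≡ y) → ∀ c → sum (λ v → 𝟙 (h v ≟ c)) ≤ 1
sum-fibre≤1 {n} h inj c with any? (λ v → h v ≟ c)
... | yes (v , refl) = ≤-trans (sum-mono-≤ (λ u → 𝟙-mono (h u ≟ h v) (u ≟ v) inj)) (≤-reflexive (sum-≟ v))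
... | no ¬v = ≤-trans (sum-mono-≤ (λ u → ≤-reflexive (𝟙-no (h u ≟ c) (¬v ∘ (u ,_)))))
  (≤-trans (≤-reflexive (sum-replicate-zero n)) z≤n)

sum-guarded : {Q : Fin n → Set} (p : Dec P) (q : ∀ v → Dec (Q v)) →
              sum (𝟙 ∘ q) ≤ 1 → sum (λ v → 𝟙 (p ×-dec q v)) ≤ 𝟙 p
sum-guarded     (yes _) q le = le
sum-guarded {n} (no _)  q le = ≤-reflexive (sum-replicate-zero n)

∣∣≤sum : (p : Subset n) (f : Fin n → ℕ) → (∀ v → v ∈ p → 1 ≤ f v) → ∣ p ∣ ≤ sum f
∣∣≤sum []            f h = z≤n
∣∣≤sum (inside ∷ p)  f h = +-mono-≤ (h zero here) (∣∣≤sum p (f ∘ suc) (λ v → h (suc v) ∘ there))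
∣∣≤sum (outside ∷ p) f h = ≤-trans (∣∣≤sum p (f ∘ suc) (λ v → h (suc v) ∘ there)) (m≤n+m _ (f zero))

sum-∈ : (p : Subset n) → sum (λ v → 𝟙 (v ∈? p)) ≡ ∣ p ∣
sum-∈ []            = refl
sum-∈ (inside ∷ p)  = cong suc (sum-∈ p)
sum-∈ (outside ∷ p) = sum-∈ p

-- Subsets cut out by decidable predicates

module _ {A : Fin n → Set} (A? : ∀ v → Dec (A v)) where

  ⟪_⟫ : Subset n
  ⟪_⟫ = tabulate (λ v → ⌊ A? v ⌋)

  lookup-⟪⟫ : ∀ v → lookup ⟪_⟫ v ≡ does (A? v)
  lookup-⟪⟫ v = trans (lookup∘tabulate (λ v → ⌊ A? v ⌋) v) (isYes≗does (A? v))

  ∈⟪⟫⁺ : ∀ {v} → A v → v ∈ ⟪_⟫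
  ∈⟪⟫⁺ {v} av = lookup⇒[]= v ⟪_⟫ (trans (lookup-⟪⟫ v) (does-cong (A? v) (yes tt) _ (λ _ → av)))

  ∈⟪⟫⁻ : ∀ {v} → v ∈ ⟪_⟫ → A v
  ∈⟪⟫⁻ {v} v∈ = does-transport (yes tt) (A? v) (trans (sym ([]=⇒lookup v∈)) (lookup-⟪⟫ v)) tt

─-∉ : (p q : Subset n) {v : Fin n} → v ∈ p ─ q → v ∉ q
─-∉ (_ ∷ p)      (_ ∷ q)       (there v∈) (there v∈q) = ─-∉ p q v∈ v∈q

∣-∣≤1 : ∀ {m n} → m ≤ suc n → n ≤ suc m → ∣ m - n ∣ ≤ 1
∣-∣≤1 {m} {n} m≤ n≤ with ≤-total m n
... | inj₁ m≤n = subst (_≤ 1) (sym (m≤n⇒∣m-n∣≡n∸m m≤n)) (m≤n+o⇒m∸n≤o n m (subst (n ≤_) (+-comm 1 m) n≤))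
... | inj₂ n≤m = subst (_≤ 1) (sym (trans (∣-∣-comm m n) (m≤n⇒∣m-n∣≡n∸m n≤m)))
  (m≤n+o⇒m∸n≤o m n (subst (m ≤_) (+-comm 1 n) m≤))

-- Parity under free involutions

module _ (σ : Fin n → Fin n) (σσ : ∀ x → σ (σ x) ≡ x) where

  sum-involution : (f : Fin n → ℕ) → sum (λ x → f (σ x)) ≡ sum f
  sum-involution f = sym (sum-permute f (permutation σ σ σσ σσ))

  module _ (free : ∀ x → σ x ≢ x) where

    -- Each pair `x`, `σ x` has a smaller member because `σ` has no fixed point; `up` keeps the
    -- values at these members only, which is half of the total.
    sum-invariant-even : (f : Fin n → ℕ) → (∀ x → f (σ x) ≡ f x) → ∃[ m ] sum f ≡ 2 * m
    sum-invariant-even f inv = sum up , (begin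
      sum f                       ≡⟨ sum-cong-≗ split ⟩
      sum (λ x → up x + up (σ x)) ≡⟨ ∑-distrib-+ up (up ∘ σ) ⟩
      sum up + sum (up ∘ σ)       ≡⟨ cong (sum up +_) (sum-involution up) ⟩
      sum up + sum up             ≡⟨ cong (sum up +_) (+-identityʳ (sum up)) ⟨
      2 * sum up                  ∎)
      where
      open ≡-Reasoning
      up : Fin n → ℕ
      up x = 𝟙 (x Fin.<? σ x) * f x
      split : ∀ x → f x ≡ up x + up (σ x)
      split x with Fin.<-cmp x (σ x)
      ... | tri< lt _ ngt rewrite σσ x | 𝟙-yes (x Fin.<? σ x) lt | 𝟙-no (σ x Fin.<? x) ngt =
        sym (trans (+-identityʳ _) (+-identityʳ _))
      ... | tri≈ _ eq _ = contradiction (sym eq) (free x)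
      ... | tri> nlt _ gt rewrite σσ x | 𝟙-no (x Fin.<? σ x) nlt | 𝟙-yes (σ x Fin.<? x) gt =
        sym (trans (+-identityʳ _) (inv x))

-- Going once around a cell (an orbit of two free involutions), a two-valued
-- function changes an even number of times, hence not exactly once.
module _ (σ ρ : Fin n → Fin n) (σσ : ∀ x → σ (σ x) ≡ x) (ρρ : ∀ x → ρ (ρ x) ≡ x)
         (σ-free : ∀ x → σ x ≢ x) (ρ-free : ∀ x → ρ x ≢ x)
         {P : Fin n → Set} (P? : ∀ x → Dec (P x))
         (Pσ : ∀ x → P x → P (σ x)) (Pρ : ∀ x → P x → P (ρ x))
         (a : Fin n → Bool) (aρ : ∀ x → P x → a x ≡ a (ρ x)) where

  private
    OffEdge : Fin n → Set
    OffEdge z = ∀ x → P x → x ≢ z → σ x ≢ z → a x ≡ a (σ x)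

    -- The elements of `P` on which `a` is true are paired up by `ρ`. Without `z` the others are
    -- still paired up by `σ`, since the partner of `z` is not among them. Two numbers that differ
    -- by one would both be even.
    no-descent : ∀ z → P z → OffEdge z → T (a z) → ¬ T (a (σ z)) → ⊥
    no-descent z Pz off az ¬aσz = even≢odd (proj₁ even) (proj₁ even′) (trans (sym (proj₂ even)) (trans total (cong suc (proj₂ even′))))
      where
      open ≡-Reasoning
      h? : ∀ x → Dec (P x × T (a x))
      h? x = P? x ×-dec T? (a x)
      h′? : ∀ x → Dec ((P x × T (a x)) × x ≢ z)
      h′? x = h? x ×-dec ¬? (x ≟ z)
      stepρ : ∀ x → P x × T (a x) → P (ρ x) × T (a (ρ x))
      stepρ x (p , t) = Pρ x p , subst T (aρ x p) t
      stepσ : ∀ x → (P x × T (a x)) × x ≢ z → (P (σ x) × T (a (σ x))) × σ x ≢ z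
      stepσ x ((p , t) , x≢z) = (Pσ x p , subst T (off x p x≢z σx≢z) t) , σx≢z
        where
        σx≢z : σ x ≢ z
        σx≢z refl = ¬aσz (subst (T ∘ a) (sym (σσ x)) t)
      even : ∃[ m ] sum (𝟙 ∘ h?) ≡ 2 * m
      even = sum-invariant-even ρ ρρ ρ-free _
        λ x → 𝟙-cong (h? (ρ x)) (h? x) (λ h → subst (λ y → P y × T (a y)) (ρρ x) (stepρ (ρ x) h)) (stepρ x)
      even′ : ∃[ m ] sum (𝟙 ∘ h′?) ≡ 2 * m
      even′ = sum-invariant-even σ σσ σ-free _
        λ x → 𝟙-cong (h′? (σ x)) (h′? x) (λ h → subst (λ y → (P y × T (a y)) × y ≢ z) (σσ x) (stepσ (σ x) h)) (stepσ x)
      split : ∀ x → 𝟙 (h? x) ≡ 𝟙 (x ≟ z) + 𝟙 (h′? x)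
      split x with x ≟ z
      ... | yes refl = trans (𝟙-yes (h? z) (Pz , az)) (cong suc (sym (𝟙-no {P = (P z × T (a z)) × z ≢ z} (h? z ×-dec no (λ z≢z → z≢z refl)) (λ h → proj₂ h refl))))
      ... | no x≢z   = 𝟙-cong (h? x) (h? x ×-dec yes x≢z) (_, x≢z) proj₁
      total : sum (𝟙 ∘ h?) ≡ suc (sum (𝟙 ∘ h′?))
      total = begin
        sum (𝟙 ∘ h?)                              ≡⟨ sum-cong-≗ split ⟩
        sum (λ x → 𝟙 (x ≟ z) + 𝟙 (h′? x))         ≡⟨ ∑-distrib-+ (λ x → 𝟙 (x ≟ z)) (𝟙 ∘ h′?) ⟩
        sum (λ x → 𝟙 (x ≟ z)) + sum (𝟙 ∘ h′?)     ≡⟨ cong (_+ sum (𝟙 ∘ h′?)) (sum-≟ z) ⟩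
        suc (sum (𝟙 ∘ h′?))                       ∎

  no-single-change : ∀ z → P z → OffEdge z → a z ≡ a (σ z)
  no-single-change z Pz off with a z in eq | a (σ z) in eq′
  ... | true  | true  = refl
  ... | false | false = refl
  ... | true  | false = ⊥-elim (no-descent z Pz off (subst T (sym eq) _) (subst T eq′))
  ... | false | true  = ⊥-elim (no-descent (σ z) (Pσ z Pz)
    (λ x p x≢σz σx≢σz → off x p (λ { refl → σx≢σz refl }) (λ { refl → x≢σz (sym (σσ x)) }))
    (subst T (sym eq′) _) (λ t → subst T (trans (cong a (σσ z)) eq) t))

-- Breadth-first distances

module BreadthFirst (R : Fin n → Fin n → Set) (R? : ∀ u v → Dec (R u v)) (root : Fin n)
  (connected : (A : Fin n → Set) → (∀ v → Dec (A v)) → A root → (∀ u v → R u v → A u → A v) → ∀ v → A v) where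

  Ball : ℕ → Fin n → Set
  Ball zero    v = v ≡ root
  Ball (suc k) v = Ball k v ⊎ ∃[ u ] (Ball k u × R u v)

  Ball? : ∀ k v → Dec (Ball k v)
  Ball? zero    v = v ≟ root
  Ball? (suc k) v = Ball? k v ⊎-dec any? (λ u → Ball? k u ×-dec R? u v)

  root∈Ball : ∀ k → Ball k root
  root∈Ball zero    = refl
  root∈Ball (suc k) = inj₁ (root∈Ball k)

  -- Connectedness, in the form that no proper decidable set containing the root is closed under
  -- `R`, gives a new element at each step until nothing is missing. So radius `n` suffices.
  Ball-grows : ∀ k → (∀ v → Ball k v) ⊎ k < sum (λ v → 𝟙 (Ball? k v))
  Ball-grows zero    = inj₂ (≤-reflexive (sym (sum-≟ root)))
  Ball-grows (suc k) with all? (Ball? (suc k)) | Ball-grows k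
  ... | yes all | _        = inj₁ all
  ... | no ¬all | inj₁ all = contradiction (inj₁ ∘ all) ¬all
  ... | no ¬all | inj₂ lt  with any? (λ w → Ball? (suc k) w ×-dec ¬? (Ball? k w))
  ...   | no ¬new = contradiction (inj₁ ∘ connected (Ball k) (Ball? k) (root∈Ball k) closed) ¬all
    where
    closed : ∀ u v → R u v → Ball k u → Ball k v
    closed u v uv bu with Ball? k v
    ... | yes bv = bv
    ... | no ¬bv = contradiction (v , inj₂ (u , bu , uv) , ¬bv) ¬new
  ...   | yes (w , new , ¬old) = inj₂ (≤-<-trans lt (sum-mono-< (λ v → 𝟙-mono (Ball? k v) (Ball? (suc k) v) inj₁) w
    (subst₂ _<_ (sym (𝟙-no (Ball? k w) ¬old)) (sym (𝟙-yes (Ball? (suc k) w) new)) ≤-refl)))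

  exhausted : ∀ v → Ball n v
  exhausted with Ball-grows n
  ... | inj₁ all = all
  ... | inj₂ lt  = contradiction lt
    (≤⇒≯ (≤-trans (sum-mono-≤ (λ v → 𝟙≤1 (Ball? n v))) (≤-reflexive (sum-const-1 n))))

  Ball-mono : ∀ {j k v} → j ≤ k → Ball j v → Ball k v
  Ball-mono {k = zero}  z≤n b = b
  Ball-mono {k = suc k} j≤k b with m≤n⇒m<n∨m≡n j≤k
  ... | inj₁ (s≤s j≤k′) = inj₁ (Ball-mono j≤k′ b)
  ... | inj₂ refl       = b

  least : ∀ {v} k → Ball k v → ∃[ j ] (j ≤ k × Ball j v × (∀ i → Ball i v → j ≤ i))
  least     zero    b = zero , z≤n , b , λ _ _ → z≤n
  least {v} (suc k) b with Ball? k v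
  ... | yes b′ = let j , j≤k , bj , min = least k b′ in j , m≤n⇒m≤1+n j≤k , bj , min
  ... | no ¬b′ = suc k , ≤-refl , b , λ i bi → ≰⇒> (λ i≤k → ¬b′ (Ball-mono i≤k bi))

  abstract
    dist : Fin n → ℕ
    dist v = proj₁ (least n (exhausted v))

    dist≤n : ∀ v → dist v ≤ n
    dist≤n v = proj₁ (proj₂ (least n (exhausted v)))

    dist∈Ball : ∀ v → Ball (dist v) v
    dist∈Ball v = proj₁ (proj₂ (proj₂ (least n (exhausted v))))

    dist-least : ∀ {v} i → Ball i v → dist v ≤ i
    dist-least {v} = proj₂ (proj₂ (proj₂ (least n (exhausted v))))

  dist-step : ∀ {u v} → R u v → dist v ≤ suc (dist u)
  dist-step {u} uv = dist-least (suc (dist u)) (inj₂ (u , dist∈Ball u , uv))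

  -- At its first ball `v` enters from some `u` in the ball before, and `dist-step` forbids that `u`
  -- is any nearer.
  parent : ∀ v → v ≢ root → ∃[ u ] (R u v × dist v ≡ suc (dist u))
  parent v v≢root with dist v in eq | dist∈Ball v
  ... | zero  | v≡root               = contradiction v≡root v≢root
  ... | suc k | inj₁ b               = contradiction (subst (_≤ k) eq (dist-least k b)) (<-irrefl refl)
  ... | suc k | inj₂ (u , b , uv)    = u , uv ,
    ≤-antisym (subst (_≤ suc (dist u)) eq (dist-step uv)) (s≤s (dist-least k b))

-- The spanning tree of the subdivision and the sets it bounds

module SurfaceTree (M : Surface) where
  open Surface M public

  Cell : Fin 3 → Set
  Cell i = Fin (#cells i)

  rep : ∀ i → Cell i → Flag
  rep i c = proj₁ (cell-onto i c)

  cell-rep : ∀ i c → cell i (rep i c) ≡ c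
  cell-rep i c = proj₂ (cell-onto i c)

  cell-τ : ∀ {i j} → j ≢ i → ∀ x → cell i (τ j x) ≡ cell i x
  cell-τ {i} {j} j≢i x = Equivalence.from (cell-≡ i (τ j x) x) ((j , j≢i , sym (τ-involutive j x)) ◅ ε)

  -- As `τ 0F` and `τ 2F` are commuting involutions, these four flags exhaust a 1-cell.
  data EdgeOrbit (x : Flag) : Flag → Set where
    same   : EdgeOrbit x x
    end    : EdgeOrbit x (τ 0F x)
    side   : EdgeOrbit x (τ 2F x)
    across : EdgeOrbit x (τ 0F (τ 2F x))

  edgeOrbit : ∀ {x y} → cell 1F x ≡ cell 1F y → EdgeOrbit x y
  edgeOrbit {x} {y} eq = walk same (Equivalence.to (cell-≡ 1F x y) eq)
    where
    step₀ : ∀ {y} → EdgeOrbit x y → EdgeOrbit x (τ 0F y)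
    step₀ same   = end
    step₀ end    = subst (EdgeOrbit x) (sym (τ-involutive 0F x)) same
    step₀ side   = across
    step₀ across = subst (EdgeOrbit x) (sym (τ-involutive 0F (τ 2F x))) side
    step₂ : ∀ {y} → EdgeOrbit x y → EdgeOrbit x (τ 2F y)
    step₂ same   = side
    step₂ end    = subst (EdgeOrbit x) (τ₀τ₂-comm x) across
    step₂ side   = subst (EdgeOrbit x) (sym (τ-involutive 2F x)) same
    step₂ across = subst (EdgeOrbit x) (trans (cong (τ 0F) (sym (τ-involutive 2F x))) (τ₀τ₂-comm (τ 2F x))) end
    walk : ∀ {y z} → EdgeOrbit x y → SameCell 1F y z → EdgeOrbit x z
    walk o ε                      = o
    walk o ((0F , _ , refl) ◅ s) = walk (step₀ o) s
    walk o ((1F , 1≢1 , _) ◅ s)  = contradiction refl 1≢1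
    walk o ((2F , _ , refl) ◅ s) = walk (step₂ o) s

  -- The two excluded flags are those at the end of `x`; the remaining two sit at the other end.
  opposite : ∀ {x y} → EdgeOrbit x y → x ≢ y → τ 2F x ≢ y → cell 0F y ≡ cell 0F (τ 0F x)
  opposite     same   x≢x _    = contradiction refl x≢x
  opposite     end    _   _    = refl
  opposite     side   _   τ≢τ  = contradiction refl τ≢τ
  opposite {x} across _   _    = trans (cong (cell 0F) (τ₀τ₂-comm x)) (cell-τ (λ ()) (τ 0F x))

  root : Cell 0F
  root = cell 0F inhabited

  Adj : Cell 0F → Cell 0F → Set
  Adj u v = ∃[ x ] (cell 0F x ≡ v × cell 0F (τ 0F x) ≡ u)

  -- A walk on flags projects to a walk in the 1-skeleton: `τ 1F` and `τ 2F` stay at the same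
  -- 0-cell, and `τ 0F` passes along an edge.
  skeleton-connected : (A : Cell 0F → Set) → (∀ v → Dec (A v)) → A root →
                       (∀ u v → Adj u v → A u → A v) → ∀ v → A v
  skeleton-connected A A? Ar closed v = subst A (cell-rep 0F v) (walk Ar (connected inhabited (rep 0F v)))
    where
    walk : ∀ {x y} → A (cell 0F x) → Star (λ p q → ∃[ j ] q ≡ τ j p) x y → A (cell 0F y)
    walk Ax ε                        = Ax
    walk {x} Ax ((0F , refl) ◅ s) =
      walk (closed _ _ (τ 0F x , refl , cong (cell 0F) (τ-involutive 0F x)) Ax) s
    walk {x} Ax ((1F , refl) ◅ s) = walk (subst A (sym (cell-τ (λ ()) x)) Ax) s
    walk {x} Ax ((2F , refl) ◅ s) = walk (subst A (sym (cell-τ (λ ()) x)) Ax) s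

  open BreadthFirst Adj
    (λ u v → any? λ x → (cell 0F x ≟ v) ×-dec (cell 0F (τ 0F x) ≟ u)) root skeleton-connected public
    using (dist; dist≤n; dist-step)
    renaming (parent to bfs-parent)

  abstract
    vertexUp : ∀ v → ∃[ x ] (cell 0F x ≡ v × (v ≢ root → dist v ≡ suc (dist (cell 0F (τ 0F x)))))
    vertexUp v with v ≟ root
    -- The root has no predecessor and receives an arbitrary flag.
    ... | yes v≡root = rep 0F v , cell-rep 0F v , λ v≢root → contradiction v≡root v≢root
    ... | no v≢root  = let u , (x , xv , xu) , eq = bfs-parent v v≢root
                       in x , xv , λ _ → subst (λ w → dist v ≡ suc (dist w)) (sym xu) eq

    edgeLow : ∀ m → ∃[ x ] (cell 1F x ≡ m × dist (cell 0F x) ≤ dist (cell 0F (τ 0F x)))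
    edgeLow m with ≤-total (dist (cell 0F (rep 1F m))) (dist (cell 0F (τ 0F (rep 1F m))))
    ... | inj₁ le = rep 1F m , cell-rep 1F m , le
    ... | inj₂ ge = τ 0F (rep 1F m) , trans (cell-τ (λ ()) _) (cell-rep 1F m) ,
      subst (λ y → dist (cell 0F (τ 0F (rep 1F m))) ≤ dist (cell 0F y)) (sym (τ-involutive 0F (rep 1F m))) ge

  vFlag : Cell 0F → Flag
  vFlag v = proj₁ (vertexUp v)

  cell-vFlag : ∀ v → cell 0F (vFlag v) ≡ v
  cell-vFlag v = proj₁ (proj₂ (vertexUp v))

  eFlag : Cell 1F → Flag
  eFlag m = proj₁ (edgeLow m)

  cell-eFlag : ∀ m → cell 1F (eFlag m) ≡ m
  cell-eFlag m = proj₁ (proj₂ (edgeLow m))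

  fFlag : Cell 2F → Flag
  fFlag = rep 2F

  up : Cell 0F → Cell 0F
  up v = cell 0F (τ 0F (vFlag v))

  dist-up : ∀ {v} → v ≢ root → dist v ≡ suc (dist (up v))
  dist-up {v} = proj₂ (proj₂ (vertexUp v))

  -- The first 0-cell on the tree path from a cell to the root; it allows tree paths to be recorded
  -- by their 0-cells alone.
  base : ∀ i → Cell i → Cell 0F
  base 0F v = v
  base 1F m = cell 0F (eFlag m)
  base 2F c = cell 0F (fFlag c)

  -- The spanning tree on all cells: a vertex hangs on the edge towards its
  -- predecessor, an edge on its end nearer to the root, a face on a corner.  The
  -- side of the triangle x opposite its i-cell is written (i , x), and equals (i , τ i x).
  VertexParent EdgeParent FaceParent : Flag → Set
  VertexParent x = cell 0F x ≢ root × x ≡ vFlag (cell 0F x)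
  EdgeParent x   = x ≡ eFlag (cell 1F x)
  FaceParent x   = x ≡ fFlag (cell 2F x)

  VertexParent? : ∀ x → Dec (VertexParent x)
  VertexParent? x = ¬? (cell 0F x ≟ root) ×-dec (x ≟ vFlag (cell 0F x))

  EdgeParent? : ∀ x → Dec (EdgeParent x)
  EdgeParent? x = x ≟ eFlag (cell 1F x)

  FaceParent? : ∀ x → Dec (FaceParent x)
  FaceParent? x = x ≟ fFlag (cell 2F x)

  -- A side of index `i` joins the barycentres of the two other cells. Faces hang on vertices, which
  -- gives index `1F`; vertices and edges hang on each other, which gives index `2F`; no tree side
  -- joins an edge to a face.
  Tree : Fin 3 → Flag → Set
  Tree 0F x = ⊥
  Tree 1F x = FaceParent x ⊎ FaceParent (τ 1F x)
  Tree 2F x = (VertexParent x ⊎ VertexParent (τ 2F x)) ⊎ (EdgeParent x ⊎ EdgeParent (τ 2F x))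

  abstract
    Tree? : ∀ i x → Dec (Tree i x)
    Tree? 0F x = no λ ()
    Tree? 1F x = FaceParent? x ⊎-dec FaceParent? (τ 1F x)
    Tree? 2F x = (VertexParent? x ⊎-dec VertexParent? (τ 2F x)) ⊎-dec (EdgeParent? x ⊎-dec EdgeParent? (τ 2F x))

  swap-⊎ : ∀ {i} (P : Flag → Set) {x} → P x ⊎ P (τ i x) → P (τ i x) ⊎ P (τ i (τ i x))
  swap-⊎ {i} P {x} (inj₁ p) = inj₂ (subst P (sym (τ-involutive i x)) p)
  swap-⊎     P     (inj₂ q) = inj₁ q

  Tree-sym : ∀ i {x} → Tree i x → Tree i (τ i x)
  Tree-sym 0F ()
  Tree-sym 1F t        = swap-⊎ FaceParent t
  Tree-sym 2F (inj₁ t) = inj₁ (swap-⊎ VertexParent t)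
  Tree-sym 2F (inj₂ t) = inj₂ (swap-⊎ EdgeParent t)

  -- The colouring `a` may change across a side outside the tree only if both ends of the side have
  -- their `base` in `Z`. As `Z` is closed towards the root, nothing that hangs below a 0-cell
  -- outside `Z` is in `Z`, so there only tree sides could carry a change; these are excluded from
  -- the leaves inwards.
  module Cut (a : Flag → Bool) (Z : Cell 0F → Set)
    (Z-up : ∀ {v} → v ≢ root → Z v → Z (up v))
    (uncut : ∀ i x → ¬ Tree i x → ∀ j → j ≢ i → ¬ Z (base j (cell j x)) → a x ≡ a (τ i x)) where

    private
      Kept : Fin 3 → Flag → Set
      Kept i x = a x ≡ a (τ i x)

      Kept-τ : ∀ {i} x → Kept i (τ i x) → Kept i x
      Kept-τ {i} x k = sym (trans k (cong a (τ-involutive i x)))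

      -- The flags of a j-cell form an orbit of `τ i` and `τ k`, so `no-single-change` applies with
      -- the side at `z` as the only possible change.
      around : ∀ i k j → i ≢ j → k ≢ j → ∀ {c} → (∀ x → cell j x ≡ c → Kept k x) →
               ∀ z → cell j z ≡ c → (∀ x → cell j x ≡ c → x ≢ z → τ i x ≢ z → Kept i x) → Kept i z
      around i k j i≢j k≢j {c} = no-single-change (τ i) (τ k) (τ-involutive i) (τ-involutive k) (τ-free i) (τ-free k)
        (λ x → cell j x ≟ c) (λ x → trans (cell-τ i≢j x)) (λ x → trans (cell-τ k≢j x)) a

    -- A face is a leaf of the tree: its parent side is the only tree side at its barycentre, and
    -- would be the only change around it.
    face-parent : ∀ c → ¬ Z (base 2F c) → Kept 1F (fFlag c)
    face-parent c ¬Zc = around 1F 0F 2F (λ ()) (λ ())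
      (λ { x refl → uncut 0F x (λ ()) 2F (λ ()) ¬Zc }) (fFlag c) (cell-rep 2F c)
      λ { x refl x≢z τx≢z → uncut 1F x
            (λ { (inj₁ p) → x≢z p ; (inj₂ p) → τx≢z (trans p (cong fFlag (cell-τ (λ ()) x))) })
            2F (λ ()) ¬Zc }

    face-edge : ∀ x → ¬ Z (cell 0F x) → Kept 1F x
    face-edge x ¬Zx with Tree? 1F x
    ... | no ¬t        = uncut 1F x ¬t 0F (λ ()) ¬Zx
    ... | yes (inj₁ p) = subst (Kept 1F) (sym p) (face-parent _ (¬Zx ∘ subst (Z ∘ cell 0F) (sym p)))
    ... | yes (inj₂ p) = Kept-τ x (subst (Kept 1F) (sym p)
      (face-parent _ (¬Zx ∘ subst Z (cell-τ (λ ()) x) ∘ subst (Z ∘ cell 0F) (sym p))))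

    mutual
      -- Induction from the deepest level upwards, where `k` exceeds the number of levels still
      -- possible below the vertex. A vertex is reduced to the edges hanging on it, and such an edge
      -- to the vertex hanging on it, one level further down.
      vertex-edge : ∀ k x → #cells 0F < dist (cell 0F x) + k → ¬ Z (cell 0F x) → Kept 2F x
      vertex-edge zero    x lt ¬Zx = contradiction (dist≤n _) (<⇒≱ (subst (#cells 0F <_) (+-identityʳ _) lt))
      vertex-edge (suc k) x lt ¬Zx with VertexParent? x | VertexParent? (τ 2F x)
      ... | no ¬p | no ¬q = vertex-edge′ k x lt ¬Zx ¬p ¬q
      ... | yes (_ , p) | _ = subst (Kept 2F) (sym p) (vertex-parent k _ lt ¬Zx)
      ... | no _ | yes (_ , q) = Kept-τ x (subst (Kept 2F) (sym q)
        (subst (λ v → Kept 2F (vFlag v)) (sym (cell-τ (λ ()) x)) (vertex-parent k _ lt ¬Zx)))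

      vertex-edge′ : ∀ k x → #cells 0F < dist (cell 0F x) + suc k → ¬ Z (cell 0F x) →
                     ¬ VertexParent x → ¬ VertexParent (τ 2F x) → Kept 2F x
      vertex-edge′ k x lt ¬Zx ¬p ¬q with Tree? 2F x
      ... | no ¬t               = uncut 2F x ¬t 0F (λ ()) ¬Zx
      ... | yes (inj₁ (inj₁ p)) = contradiction p ¬p
      ... | yes (inj₁ (inj₂ q)) = contradiction q ¬q
      ... | yes (inj₂ (inj₁ e)) = subst (Kept 2F) (sym e)
        (edge-parent k _ (subst (λ y → #cells 0F < dist (cell 0F y) + suc k) e lt) (¬Zx ∘ subst (Z ∘ cell 0F) (sym e)))
      ... | yes (inj₂ (inj₂ e)) = Kept-τ x (subst (Kept 2F) (sym e)
        (edge-parent k _ (subst (λ v → #cells 0F < dist v + suc k) same-vertex lt) (¬Zx ∘ subst Z (sym same-vertex))))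
        where
        same-vertex : cell 0F x ≡ cell 0F (eFlag (cell 1F (τ 2F x)))
        same-vertex = trans (sym (cell-τ (λ ()) x)) (cong (cell 0F) e)

      -- All other sides at `v` are settled first: those to faces by `face-edge`, those to edges by
      -- descending to the edges that hang on `v`.
      vertex-parent : ∀ k v → #cells 0F < dist v + suc k → ¬ Z v → Kept 2F (vFlag v)
      vertex-parent k v lt ¬Zv = around 2F 1F 0F (λ ()) (λ ())
        (λ { x refl → face-edge x ¬Zv }) (vFlag v) (cell-vFlag v)
        λ { x refl x≢z τx≢z → vertex-edge′ k x lt ¬Zv (λ p → x≢z (proj₂ p))
              (λ q → τx≢z (trans (proj₂ q) (cong vFlag (cell-τ (λ ()) x)))) }

      -- Of the four sides at the barycentre of an edge, the two to faces are never in the tree, and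
      -- the one to the far end is in the tree only if the vertex there hangs on the edge.
      edge-parent : ∀ k m → #cells 0F < dist (base 1F m) + suc k → ¬ Z (base 1F m) → Kept 2F (eFlag m)
      edge-parent k m lt ¬Zm = around 2F 0F 1F (λ ()) (λ ())
        (λ { x refl → uncut 0F x (λ ()) 1F (λ ()) ¬Zm }) (eFlag m) (cell-eFlag m) off
        where
        -- A vertex whose parent is m lies one level below the base of m, at the opposite end of the edge.
        child : ∀ x → cell 1F x ≡ m → x ≢ eFlag m → τ 2F x ≢ eFlag m → VertexParent x → Kept 2F x
        child x refl x≢z τx≢z (v≢root , p) = vertex-edge k x
          (subst (#cells 0F <_) (trans (+-suc _ k) (cong (_+ k) (sym level))) lt) (¬Zm ∘ subst Z up≡base ∘ Z-up v≢root)
          where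
          up≡end : up (cell 0F x) ≡ cell 0F (τ 0F x)
          up≡end = cong (cell 0F ∘ τ 0F) (sym p)
          up≡base : up (cell 0F x) ≡ base 1F m
          up≡base = trans up≡end (sym (opposite (edgeOrbit (sym (cell-eFlag (cell 1F x)))) x≢z τx≢z))
          level : dist (cell 0F x) ≡ suc (dist (base 1F m))
          level = trans (dist-up v≢root) (cong (suc ∘ dist) up≡base)
        off : ∀ x → cell 1F x ≡ m → x ≢ eFlag m → τ 2F x ≢ eFlag m → Kept 2F x
        off x refl x≢z τx≢z with Tree? 2F x
        ... | no ¬t               = uncut 2F x ¬t 1F (λ ()) ¬Zm
        ... | yes (inj₁ (inj₁ p)) = child x refl x≢z τx≢z p
        ... | yes (inj₁ (inj₂ p)) = Kept-τ x (child (τ 2F x) (cell-τ (λ ()) x) τx≢z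
          (λ eq → x≢z (trans (sym (τ-involutive 2F x)) eq)) p)
        ... | yes (inj₂ (inj₁ e)) = contradiction e x≢z
        ... | yes (inj₂ (inj₂ e)) = contradiction (trans e (cong eFlag (cell-τ (λ ()) x))) τx≢z

    kept-at : ∀ i → i ≢ 0F → ∀ x → ¬ Z (cell 0F x) → Kept i x
    kept-at 0F 0≢0 _ _ = contradiction refl 0≢0
    kept-at 1F _ x ¬Zx = face-edge x ¬Zx
    kept-at 2F _ x ¬Zx = vertex-edge (suc (#cells 0F)) x (m≤n+m _ (dist (cell 0F x))) ¬Zx

    constant-at : ∀ x y → cell 0F x ≡ cell 0F y → ¬ Z (cell 0F x) → a x ≡ a y
    constant-at x y eq ¬Zx = walk x y ¬Zx (Equivalence.to (cell-≡ 0F x y) eq)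
      where
      walk : ∀ x y → ¬ Z (cell 0F x) → SameCell 0F x y → a x ≡ a y
      walk x _ ¬Zx ε                       = refl
      walk x y ¬Zx ((j , j≢0 , refl) ◅ s) =
        trans (kept-at j j≢0 x ¬Zx) (walk (τ j x) y (¬Zx ∘ subst Z (cell-τ j≢0 x)) s)

-- The dual spanning tree and the sides in neither tree

module DualTree (M : Surface) where
  open SurfaceTree M public

  Move : Flag → Flag → Set
  Move x y = ∃[ i ] (¬ Tree i x × y ≡ τ i x)

  -- A set closed under moves is bounded by tree sides only. By `Cut` with empty `Z` it has no
  -- boundary at all, and connectedness of the surface makes it everything.
  dual-connected : (A : Flag → Set) → (∀ x → Dec (A x)) → A inhabited →
                   (∀ x y → Move x y → A x → A y) → ∀ x → A x
  dual-connected A A? A₀ closed x = walk A₀ (connected inhabited x)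
    where
    uncut : ∀ i x → ¬ Tree i x → does (A? x) ≡ does (A? (τ i x))
    uncut i x ¬t = does-cong (A? x) (A? (τ i x)) (closed _ _ (i , ¬t , refl))
      (closed _ _ (i , (λ t → ¬t (subst (Tree i) (τ-involutive i x) (Tree-sym i t))) , sym (τ-involutive i x)))
    open Cut (does ∘ A?) (λ _ → ⊥) (λ _ ()) (λ i x ¬t _ _ _ → uncut i x ¬t)
    kept : ∀ i x → does (A? x) ≡ does (A? (τ i x))
    kept 0F x = uncut 0F x λ ()
    kept 1F x = kept-at 1F (λ ()) x λ ()
    kept 2F x = kept-at 2F (λ ()) x λ ()
    walk : ∀ {x y} → A x → Star (λ p q → ∃[ j ] q ≡ τ j p) x y → A y
    walk Ax ε                    = Ax
    walk {x} Ax ((j , refl) ◅ s) = walk (does-transport (A? x) (A? (τ j x)) (kept j x) Ax) s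

  open BreadthFirst Move (λ x y → any? λ i → ¬? (Tree? i x) ×-dec (y ≟ τ i x)) inhabited dual-connected public
    using () renaming (dist to depth; dist≤n to depth≤; parent to dual-parent)

  abstract
    exit : ∀ x → ∃[ i ] (x ≢ inhabited → ¬ Tree i x × depth x ≡ suc (depth (τ i x)))
    exit x with x ≟ inhabited
    -- A dummy side for the root of the dual tree; `DualParent` excludes that flag.
    ... | yes x≡ = 0F , λ x≢ → contradiction x≡ x≢
    ... | no x≢ with dual-parent x x≢
    ...   | u , (i , ¬t , refl) , eq = i , λ _ → ¬t ∘ subst (Tree i) (τ-involutive i u) ∘ Tree-sym i ,
      trans eq (cong (suc ∘ depth) (sym (τ-involutive i u)))

  side-of : Flag → Fin 3
  side-of x = proj₁ (exit x)

  next : Flag → Flag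
  next x = τ (side-of x) x

  depth-next : ∀ {x} → x ≢ inhabited → depth x ≡ suc (depth (next x))
  depth-next {x} x≢ = proj₂ (proj₂ (exit x) x≢)

  DualParent : Fin 3 → Flag → Set
  DualParent i x = x ≢ inhabited × side-of x ≡ i

  DualParent? : ∀ i x → Dec (DualParent i x)
  DualParent? i x = ¬? (x ≟ inhabited) ×-dec (side-of x ≟ i)

  Dual : Fin 3 → Flag → Set
  Dual i x = DualParent i x ⊎ DualParent i (τ i x)

  abstract
    Dual? : ∀ i x → Dec (Dual i x)
    Dual? i x = DualParent? i x ⊎-dec DualParent? i (τ i x)

  Extra : Fin 3 → Flag → Set
  Extra i x = ¬ Tree i x × ¬ Dual i x

  abstract
    Extra? : ∀ i x → Dec (Extra i x)
    Extra? i x = ¬? (Tree? i x) ×-dec ¬? (Dual? i x)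

  Extra-sym : ∀ i {x} → Extra i x → Extra i (τ i x)
  Extra-sym i {x} (¬t , ¬d) =
    ¬t ∘ subst (Tree i) (τ-involutive i x) ∘ Tree-sym i ,
    ¬d ∘ subst (Dual i) (τ-involutive i x) ∘ swap-⊎ (DualParent i)

  -- If each of two flags were the parent of the other, the depth would drop twice on returning to
  -- `x`.
  DualParent-once : ∀ i x → DualParent i x → DualParent i (τ i x) → ⊥
  DualParent-once i x (x≢ , refl) (τx≢ , eq) =
    m≢1+n+m (depth x) {1} (trans (depth-next x≢) (cong suc (trans (depth-next τx≢)
      (cong (suc ∘ depth) (trans (cong (λ j → τ j (next x)) eq) (τ-involutive i x))))))

  Tree-Dual : ∀ i x → Tree i x → Dual i x → ⊥
  Tree-Dual i x t (inj₁ (x≢ , refl)) = proj₁ (proj₂ (exit x) x≢) t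
  Tree-Dual i x t (inj₂ (τx≢ , eq)) =
    proj₁ (proj₂ (exit (τ i x)) τx≢) (subst (λ j → Tree j (τ i x)) (sym eq) (Tree-sym i t))

  -- Counting the extra sides with Euler's formula

  # : {P : Flag → Set} → (∀ x → Dec (P x)) → ℕ
  # P? = sum (λ x → 𝟙 (P? x))

  #-∪ : {P Q R : Flag → Set} (P? : ∀ x → Dec (P x)) (Q? : ∀ x → Dec (Q x)) (R? : ∀ x → Dec (R x)) →
        (∀ x → P x → Q x → ⊥) → (∀ x → P x → R x) → (∀ x → Q x → R x) → # P? + # Q? ≤ # R?
  #-∪ P? Q? R? disjoint P⊆R Q⊆R = subst (_≤ # R?) (∑-distrib-+ (𝟙 ∘ P?) (𝟙 ∘ Q?))
    (sum-mono-≤ λ x → 𝟙-+ (P? x) (Q? x) (R? x) (disjoint x) (P⊆R x) (Q⊆R x))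

  #-τ : ∀ i {P : Flag → Set} (P? : ∀ x → Dec (P x)) → # (λ x → P? (τ i x)) ≡ # P?
  #-τ i P? = sum-involution (τ i) (τ-involutive i) (𝟙 ∘ P?)

  -- Here `P` marks at most one of the two names of a side while `R` holds for both names, hence the
  -- factor two.
  #-double : ∀ i {P R : Flag → Set} (P? : ∀ x → Dec (P x)) (R? : ∀ x → Dec (R x)) →
             (∀ x → P x → P (τ i x) → ⊥) → (∀ x → P x ⊎ P (τ i x) → R x) → # P? + # P? ≤ # R?
  #-double i P? R? disjoint ⊆R = subst (λ m → # P? + m ≤ # R?) (#-τ i P?)
    (#-∪ P? (P? ∘ τ i) R? disjoint (λ x → ⊆R x ∘ inj₁) (λ x → ⊆R x ∘ inj₂))

  #≤flags : {P : Flag → Set} (P? : ∀ x → Dec (P x)) → # P? ≤ #flags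
  #≤flags P? = ≤-trans (sum-mono-≤ (λ x → 𝟙≤1 (P? x))) (≤-reflexive (sum-const-1 #flags))

  -- The names of extra, dual and tree sides of one index are disjoint sets of flags. `DualParent`
  -- picks one name of each dual side and is therefore counted twice.
  Extra-Dual-Tree : ∀ i → # (Extra? i) + (# (DualParent? i) + # (DualParent? i) + # (Tree? i)) ≤ #flags
  Extra-Dual-Tree i = begin
    # (Extra? i) + (# (DualParent? i) + # (DualParent? i) + # (Tree? i))
      ≤⟨ +-monoʳ-≤ (# (Extra? i)) (+-monoˡ-≤ (# (Tree? i))
           (#-double i (DualParent? i) (Dual? i) (DualParent-once i) (λ _ d → d))) ⟩
    # (Extra? i) + (# (Dual? i) + # (Tree? i))
      ≤⟨ +-monoʳ-≤ (# (Extra? i)) (#-∪ (Dual? i) (Tree? i) used? (λ x d t → Tree-Dual i x t d) (λ _ → inj₁) (λ _ → inj₂)) ⟩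
    # (Extra? i) + # used?
      ≤⟨ #-∪ (Extra? i) used? (λ _ → yes tt)
           (λ { x (_ , ¬d) (inj₁ d) → ¬d d ; x (¬t , _) (inj₂ t) → ¬t t }) _ _ ⟩
    # (λ _ → yes tt)
      ≤⟨ #≤flags (λ _ → yes tt) ⟩
    #flags ∎
    where
    open ≤-Reasoning
    used? : ∀ x → Dec (Dual i x ⊎ Tree i x)
    used? x = Dual? i x ⊎-dec Tree? i x

  -- The dual tree has one edge fewer than it has nodes: each flag but the root leaves through
  -- exactly one side.
  #DualParent : # (DualParent? 0F) + # (DualParent? 1F) + # (DualParent? 2F) + 1 ≡ #flags
  #DualParent = trans (cong (_+ 1) (sym (begin
    # nonroot?                                                       ≡⟨ sum-cong-≗ (λ x → split (¬? (x ≟ inhabited)) (side-of x)) ⟩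
    sum (λ x → 𝟙 (DualParent? 0F x) + 𝟙 (DualParent? 1F x) + 𝟙 (DualParent? 2F x))
      ≡⟨ ∑-distrib-+ (λ x → 𝟙 (DualParent? 0F x) + 𝟙 (DualParent? 1F x)) (𝟙 ∘ DualParent? 2F) ⟩
    sum (λ x → 𝟙 (DualParent? 0F x) + 𝟙 (DualParent? 1F x)) + # (DualParent? 2F)
      ≡⟨ cong (_+ # (DualParent? 2F)) (∑-distrib-+ (𝟙 ∘ DualParent? 0F) (𝟙 ∘ DualParent? 1F)) ⟩
    # (DualParent? 0F) + # (DualParent? 1F) + # (DualParent? 2F)     ∎))) (sum-≢ inhabited)
    where
    open ≡-Reasoning
    nonroot? : ∀ x → Dec (x ≢ inhabited)
    nonroot? x = ¬? (x ≟ inhabited)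
    split : ∀ {P} (p : Dec P) (i : Fin 3) → 𝟙 p ≡ 𝟙 (p ×-dec (i ≟ 0F)) + 𝟙 (p ×-dec (i ≟ 1F)) + 𝟙 (p ×-dec (i ≟ 2F))
    split (no _)  _  = refl
    split (yes _) 0F = refl
    split (yes _) 1F = refl
    split (yes _) 2F = refl

  -- With the next two counts this gives one less than the number of cells, the number of edges of
  -- the spanning tree.
  #VertexParent : # VertexParent? + 1 ≡ #cells 0F
  #VertexParent = trans (cong (_+ 1) (sum-section (λ v → ¬? (v ≟ root)) (cell 0F) vFlag cell-vFlag)) (sum-≢ root)

  #EdgeParent : # EdgeParent? ≡ #cells 1F
  #EdgeParent = trans (sum-section (λ _ → yes tt) (cell 1F) eFlag cell-eFlag) (sum-const-1 _)

  #FaceParent : # FaceParent? ≡ #cells 2F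
  #FaceParent = trans (sum-section (λ _ → yes tt) (cell 2F) fFlag (cell-rep 2F)) (sum-const-1 _)

  #Tree₁ : # FaceParent? + # FaceParent? ≤ # (Tree? 1F)
  #Tree₁ = #-double 1F FaceParent? (Tree? 1F)
    (λ x p q → τ-free 1F x (trans q (trans (cong fFlag (cell-τ (λ ()) x)) (sym p)))) (λ _ t → t)

  -- The parent side of a vertex starts an edge leading strictly nearer to the root, whereas the
  -- parent side of an edge sits at an end that is no farther than the other.
  Vertex-Edge : ∀ x → VertexParent x ⊎ VertexParent (τ 2F x) → EdgeParent x ⊎ EdgeParent (τ 2F x) → ⊥
  Vertex-Edge x (inj₂ p) e = Vertex-Edge (τ 2F x) (inj₁ p) (swap-⊎ EdgeParent e)
  Vertex-Edge x (inj₁ (v≢root , p)) e = <-irrefl refl (begin-strict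
    dist (cell 0F (τ 0F x))   ≡⟨ cong (dist ∘ cell 0F ∘ τ 0F) p ⟩
    dist (up (cell 0F x))     <⟨ ≤-reflexive (sym (dist-up v≢root)) ⟩
    dist (cell 0F x)          ≤⟨ low e ⟩
    dist (cell 0F (τ 0F x))   ∎)
    where
    open ≤-Reasoning
    low : EdgeParent x ⊎ EdgeParent (τ 2F x) → dist (cell 0F x) ≤ dist (cell 0F (τ 0F x))
    low (inj₁ e) = subst (λ y → dist (cell 0F y) ≤ dist (cell 0F (τ 0F y))) (sym e) (proj₂ (proj₂ (edgeLow _)))
    low (inj₂ e) = subst₂ (λ u v → dist u ≤ dist v) (cell-τ (λ ()) x)
      (trans (cong (cell 0F) (τ₀τ₂-comm x)) (cell-τ (λ ()) (τ 0F x)))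
      (subst (λ y → dist (cell 0F y) ≤ dist (cell 0F (τ 0F y))) (sym e) (proj₂ (proj₂ (edgeLow _))))

  #Tree₂ : (# VertexParent? + # VertexParent?) + (# EdgeParent? + # EdgeParent?) ≤ # (Tree? 2F)
  #Tree₂ = ≤-trans (+-mono-≤
      (#-double 2F VertexParent? vertex? (λ x p q → τ-free 2F x
        (trans (proj₂ q) (trans (cong vFlag (cell-τ (λ ()) x)) (sym (proj₂ p))))) (λ _ t → t))
      (#-double 2F EdgeParent? edge? (λ x p q → τ-free 2F x
        (trans q (trans (cong eFlag (cell-τ (λ ()) x)) (sym p)))) (λ _ t → t)))
    (#-∪ vertex? edge? (Tree? 2F) Vertex-Edge (λ _ → inj₁) (λ _ → inj₂))
    where
    vertex? : ∀ x → Dec (VertexParent x ⊎ VertexParent (τ 2F x))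
    vertex? x = VertexParent? x ⊎-dec VertexParent? (τ 2F x)
    edge? : ∀ x → Dec (EdgeParent x ⊎ EdgeParent (τ 2F x))
    edge? x = EdgeParent? x ⊎-dec EdgeParent? (τ 2F x)

  -- Every flag is among the four flags in the orbit of the chosen flag of its edge.
  #flags≤ : #flags ≤ (#cells 1F + #cells 1F) + (#cells 1F + #cells 1F)
  #flags≤ = begin
    #flags                                                      ≡⟨ sum-const-1 #flags ⟨
    sum {#flags} (λ _ → 1)                                      ≤⟨ sum-mono-≤ (λ x → covered (edgeOrbit (sym (cell-eFlag (cell 1F x))))) ⟩
    sum (λ x → (e x + e (τ 0F x)) + (e (τ 2F x) + e (τ 0F (τ 2F x))))
      ≡⟨ ∑-distrib-+ (λ x → e x + e (τ 0F x)) (λ x → e (τ 2F x) + e (τ 0F (τ 2F x))) ⟩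
    sum (λ x → e x + e (τ 0F x)) + sum (λ x → e (τ 2F x) + e (τ 0F (τ 2F x)))
      ≡⟨ cong (sum (λ x → e x + e (τ 0F x)) +_) (sum-involution (τ 2F) (τ-involutive 2F) (λ x → e x + e (τ 0F x))) ⟩
    sum (λ x → e x + e (τ 0F x)) + sum (λ x → e x + e (τ 0F x)) ≡⟨ cong₂ _+_ pair pair ⟩
    (#cells 1F + #cells 1F) + (#cells 1F + #cells 1F)           ∎
    where
    open ≤-Reasoning
    e : Flag → ℕ
    e x = 𝟙 (EdgeParent? x)
    pair : sum (λ x → e x + e (τ 0F x)) ≡ #cells 1F + #cells 1F
    pair = trans (∑-distrib-+ e (e ∘ τ 0F)) (cong₂ _+_ #EdgeParent (trans (#-τ 0F EdgeParent?) #EdgeParent))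
    covered : ∀ {x} → EdgeOrbit x (eFlag (cell 1F x)) → 1 ≤ (e x + e (τ 0F x)) + (e (τ 2F x) + e (τ 0F (τ 2F x)))
    covered {x} o = hit refl o
      where
      hit : ∀ {y} → y ≡ eFlag (cell 1F x) → EdgeOrbit x y → 1 ≤ (e x + e (τ 0F x)) + (e (τ 2F x) + e (τ 0F (τ 2F x)))
      hit p same   = ≤-trans (≤-reflexive (sym (𝟙-yes (EdgeParent? x) p))) (≤-trans (m≤m+n _ _) (m≤m+n _ _))
      hit p end    = ≤-trans (≤-reflexive (sym (𝟙-yes (EdgeParent? (τ 0F x)) (trans p (cong eFlag (sym (cell-τ (λ ()) x)))))))
        (≤-trans (m≤n+m _ (e x)) (m≤m+n _ _))
      hit p side   = ≤-trans (≤-reflexive (sym (𝟙-yes (EdgeParent? (τ 2F x)) (trans p (cong eFlag (sym (cell-τ (λ ()) x)))))))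
        (≤-trans (m≤m+n _ _) (m≤n+m _ (e x + e (τ 0F x))))
      hit p across = ≤-trans (≤-reflexive (sym (𝟙-yes (EdgeParent? (τ 0F (τ 2F x)))
          (trans p (cong eFlag (sym (trans (cell-τ (λ ()) (τ 2F x)) (cell-τ (λ ()) x))))))))
        (≤-trans (m≤n+m _ (e (τ 2F x))) (m≤n+m _ (e x + e (τ 0F x))))

  -- Euler's formula with the subtractions cleared, so that it can be used in ℕ.
  euler : ∀ {g} → eulerGenus ≡ ℤ.+ g → 2 + #cells 1F ≡ g + (#cells 0F + #cells 2F)
  euler {g} eq = ℤ.+-injective (begin
    ℤ.+ (2 + #cells 1F)                                        ≡⟨⟩
    ℤ.+ 2 ℤ.+ ℤ.+ #cells 1F                                    ≡⟨ rearrange (ℤ.+ 2) (ℤ.+ #cells 0F) (ℤ.+ #cells 1F) (ℤ.+ #cells 2F) ⟩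
    eulerGenus ℤ.+ (ℤ.+ #cells 0F ℤ.+ ℤ.+ #cells 2F)           ≡⟨ cong (ℤ._+ (ℤ.+ #cells 0F ℤ.+ ℤ.+ #cells 2F)) eq ⟩
    ℤ.+ (g + (#cells 0F + #cells 2F))                          ∎)
    where
    open ≡-Reasoning
    rearrange : ∀ t v e f → t ℤ.+ e ≡ (t ℤ.- (v ℤ.- e ℤ.+ f)) ℤ.+ (v ℤ.+ f)
    rearrange = ℤ-Solver.solve-∀

  -- Let N, V, E, F count flags and cells. Of the 3N pairs of an index and a flag, the dual tree
  -- takes 2(N - 1) and the tree 2(V + E + F - 1). This leaves at most N + 4 - 2V - 2E - 2F, and N ≤
  -- 4E bounds that by 2(2 + E - V - F) = 2g. Each extra side is counted under both its names.
  #Extra : ∀ {g} → eulerGenus ≡ ℤ.+ g → # (Extra? 0F) + # (Extra? 1F) + # (Extra? 2F) ≤ 2 * g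
  #Extra {g} eq = cancel (# (Extra? 0F)) (# (Extra? 1F)) (# (Extra? 2F)) (# (DualParent? 0F)) (# (DualParent? 1F)) (# (DualParent? 2F)) (# VertexParent?)
    #DualParent #VertexParent (euler eq) #flags≤
    (≤-trans (+-monoʳ-≤ (# (Extra? 0F)) (m≤m+n _ (# (Tree? 0F)))) (Extra-Dual-Tree 0F))
    (≤-trans (+-monoʳ-≤ (# (Extra? 1F)) (+-monoʳ-≤ (# (DualParent? 1F) + # (DualParent? 1F))
      (subst (λ m → m + m ≤ # (Tree? 1F)) #FaceParent #Tree₁))) (Extra-Dual-Tree 1F))
    (≤-trans (+-monoʳ-≤ (# (Extra? 2F)) (+-monoʳ-≤ (# (DualParent? 2F) + # (DualParent? 2F))
      (subst (λ m → (# VertexParent? + # VertexParent?) + (m + m) ≤ # (Tree? 2F)) #EdgeParent #Tree₂))) (Extra-Dual-Tree 2F))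
    where
    cancel : ∀ x₀ x₁ x₂ {V E F N} s₀ s₁ s₂ v → s₀ + s₁ + s₂ + 1 ≡ N → v + 1 ≡ V → 2 + E ≡ g + (V + F) →
             N ≤ (E + E) + (E + E) →
             x₀ + (s₀ + s₀) ≤ N → x₁ + (s₁ + s₁ + (F + F)) ≤ N → x₂ + (s₂ + s₂ + ((v + v) + (E + E))) ≤ N →
             x₀ + x₁ + x₂ ≤ 2 * g
    cancel x₀ x₁ x₂ {V} {E} {F} {N} s₀ s₁ s₂ v refl refl eul N≤ h₀ h₁ h₂ =
      +-cancelʳ-≤ k (x₀ + x₁ + x₂) (2 * g) (begin
        x₀ + x₁ + x₂ + k ≡⟨ lhs x₀ x₁ x₂ s₀ s₁ s₂ v E F ⟩
        (x₀ + (s₀ + s₀)) + (x₁ + (s₁ + s₁ + (F + F))) + (x₂ + (s₂ + s₂ + ((v + v) + (E + E)))) + 4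
          ≤⟨ +-monoˡ-≤ 4 (+-mono-≤ (+-mono-≤ h₀ h₁) h₂) ⟩
        N + N + N + 4
          ≤⟨ +-monoˡ-≤ 4 (+-monoʳ-≤ (N + N) N≤) ⟩
        N + N + ((E + E) + (E + E)) + 4
          ≡⟨ mid N E ⟩
        (2 + E) + (2 + E) + (N + N + E + E)
          ≡⟨ cong (λ m → m + m + (N + N + E + E)) eul ⟩
        (g + (v + 1 + F)) + (g + (v + 1 + F)) + (N + N + E + E)
          ≡⟨ rhs g s₀ s₁ s₂ v E F ⟩
        2 * g + k ∎)
      where
      open ≤-Reasoning
      -- The terms that the estimate subtracts, added to both sides instead.
      k : ℕ
      k = (s₀ + s₁ + s₂ + 1) + (s₀ + s₁ + s₂ + 1) + (v + 1 + F) + (v + 1 + F) + E + E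
      lhs : ∀ x₀ x₁ x₂ s₀ s₁ s₂ v E F →
            x₀ + x₁ + x₂ + ((s₀ + s₁ + s₂ + 1) + (s₀ + s₁ + s₂ + 1) + (v + 1 + F) + (v + 1 + F) + E + E) ≡
            (x₀ + (s₀ + s₀)) + (x₁ + (s₁ + s₁ + (F + F))) + (x₂ + (s₂ + s₂ + ((v + v) + (E + E)))) + 4
      lhs = solve-∀
      mid : ∀ N E → N + N + ((E + E) + (E + E)) + 4 ≡ (2 + E) + (2 + E) + (N + N + E + E)
      mid = solve-∀
      rhs : ∀ g s₀ s₁ s₂ v E F → (g + (v + 1 + F)) + (g + (v + 1 + F)) + ((s₀ + s₁ + s₂ + 1) + (s₀ + s₁ + s₂ + 1) + E + E) ≡
            2 * g + ((s₀ + s₁ + s₂ + 1) + (s₀ + s₁ + s₂ + 1) + (v + 1 + F) + (v + 1 + F) + E + E)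
      rhs = solve-∀

-- The layering and the paths to the root

module Separator (M : Surface) {g : ℕ} (genus : Surface.eulerGenus M ≡ ℤ.+ g) {G : Graph} (emb : G EmbedsIn M) where
  open DualTree M
  open Graph G
  open _EmbedsIn_ emb

  -- Distances are taken in the 1-skeleton of `M`, which is connected even if `G` is not. Edges of
  -- `G` lie in the skeleton, so their ends differ by at most one level.
  layering : Layering G
  layering = record
    { t       = #cells 0F
    ; layerOf = λ v → fromℕ< (s≤s (dist≤n (vertex v)))
    ; close   = λ {v} {w} v~w → subst₂ (λ k l → ∣ k - l ∣ ≤ 1)
        (sym (Fin.toℕ-fromℕ< (s≤s (dist≤n (vertex v))))) (sym (Fin.toℕ-fromℕ< (s≤s (dist≤n (vertex w)))))
        (∣-∣≤1 (near v~w) (near (~-sym v~w)))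
    }
    where
    near : ∀ {v w} → v ~ w → dist (vertex v) ≤ suc (dist (vertex w))
    near v~w = let x , xv , xw = edge v~w in dist-step (x , xv , xw)

  open Layering layering using (layer; layerOf)

  toℕ-layerOf : ∀ v → toℕ (layerOf v) ≡ dist (vertex v)
  toℕ-layerOf v = Fin.toℕ-fromℕ< (s≤s (dist≤n (vertex v)))

  climb : ℕ → Cell 0F → Cell 0F
  climb zero    v = v
  climb (suc k) v = up (climb k v)

  -- Each step towards the root lowers the distance by one, so the distance of `v` determines the
  -- step at which it can occur. In this form it is evident that a path has one vertex per layer.
  OnPath : Cell 0F → Cell 0F → Set
  OnPath w v = v ≡ climb (dist w ∸ dist v) w

  OnPath-refl : ∀ v → OnPath v v
  OnPath-refl v = cong (λ k → climb k v) (sym (n∸n≡0 (dist v)))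

  OnPath-up : ∀ w {v} → v ≢ root → OnPath w v → OnPath w (up v)
  OnPath-up w {v} v≢root on with dist v ≤? dist w
  ... | yes v≤w = trans (cong up on) (cong (λ k → climb k w)
    (trans (sym (+-∸-assoc 1 v≤w)) (cong (suc (dist w) ∸_) (dist-up v≢root))))
  -- The truncated difference is zero here, so `v` would be `w` itself.
  ... | no v≰w  = contradiction (≤-reflexive (cong dist (trans on (cong (λ k → climb k w) (m≤n⇒m∸n≡0 (≰⇒≥ v≰w)))))) v≰w

  end₁ end₂ : Fin 3 → Fin 3
  end₁ 0F = 1F
  end₁ 1F = 0F
  end₁ 2F = 0F
  end₂ 0F = 2F
  end₂ 1F = 2F
  end₂ 2F = 1F

  base-at : Fin 3 → Flag → Cell 0F
  base-at j x = base j (cell j x)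

  base-τ : ∀ {i j} → j ≢ i → ∀ x → base-at j (τ i x) ≡ base-at j x
  base-τ j≢i x = cong (base _) (cell-τ (j≢i ∘ sym) x)

  -- The side (i , x) is also (i , τ i x); giving these two names its two ends makes
  -- 2 g anchors suffice for the g extra sides.
  anchor : Fin 3 → Flag → Cell 0F
  anchor i x = if does (x Fin.<? τ i x) then base-at (end₁ i) x else base-at (end₂ i) x

  anchor-< : ∀ i x → toℕ x < toℕ (τ i x) → anchor i x ≡ base-at (end₁ i) x
  anchor-< i x lt = if-yes (x Fin.<? τ i x) lt

  anchor-≮ : ∀ i x → ¬ toℕ x < toℕ (τ i x) → anchor i x ≡ base-at (end₂ i) x
  anchor-≮ i x nlt = if-no (x Fin.<? τ i x) nlt

  end-cases : ∀ i j → j ≢ i → (j ≡ end₁ i) ⊎ (j ≡ end₂ i)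
  end-cases 0F 0F j≢i = contradiction refl j≢i
  end-cases 0F 1F j≢i = inj₁ refl
  end-cases 0F 2F j≢i = inj₂ refl
  end-cases 1F 0F j≢i = inj₁ refl
  end-cases 1F 1F j≢i = contradiction refl j≢i
  end-cases 1F 2F j≢i = inj₂ refl
  end-cases 2F 0F j≢i = inj₁ refl
  end-cases 2F 1F j≢i = inj₂ refl
  end-cases 2F 2F j≢i = contradiction refl j≢i

  -- One of the two names of the side is anchored at the wanted end, and both names have the same
  -- cell of index `j`.
  anchored : ∀ i x j → j ≢ i → Extra i x → ∃[ y ] (Extra i y × anchor i y ≡ base-at j x)
  anchored i x j j≢i e with end-cases i j j≢i | Fin.<-cmp x (τ i x)
  ... | _         | tri≈ _ eq _   = contradiction (sym eq) (τ-free i x)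
  ... | inj₁ refl | tri< lt _ _   = x , e , anchor-< i x lt
  ... | inj₂ refl | tri> nlt _ _  = x , e , anchor-≮ i x nlt
  ... | inj₁ refl | tri> _ _ gt   = τ i x , Extra-sym i e ,
    trans (anchor-< i (τ i x) (subst (λ y → toℕ (τ i x) < toℕ y) (sym (τ-involutive i x)) gt)) (base-τ j≢i x)
  ... | inj₂ refl | tri< _ _ ngt  = τ i x , Extra-sym i e ,
    trans (anchor-≮ i (τ i x) (ngt ∘ subst (λ y → toℕ (τ i x) < toℕ y) (τ-involutive i x))) (base-τ j≢i x)

  -- Subtrees of the dual tree

  data Desc (f : Flag) : Flag → Set where
    here : Desc f f
    step : ∀ {x} → x ≢ inhabited → Desc f (next x) → Desc f x

  abstract
    Desc? : ∀ f x → Dec (Desc f x)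
    Desc? f x = search (depth x) x ≤-refl
      where
      search : ∀ k x → depth x ≤ k → Dec (Desc f x)
      search k x le with x ≟ f | x ≟ inhabited
      ... | yes refl | _       = yes here
      ... | no x≢f   | yes x≡  = no λ { here → x≢f refl ; (step x≢ _) → x≢ x≡ }
      search zero x le | no _ | no x≢ = contradiction (subst (_≤ 0) (depth-next x≢) le) (λ ())
      search (suc k) x le | no x≢f | no x≢ with search k (next x) (s≤s⁻¹ (subst (_≤ suc k) (depth-next x≢) le))
      ... | yes d = yes (step x≢ d)
      ... | no ¬d = no λ { here → x≢f refl ; (step _ d) → ¬d d }

  Desc-root : ∀ x → Desc inhabited x
  Desc-root x = search (depth x) x ≤-refl
    where
    search : ∀ k x → depth x ≤ k → Desc inhabited x
    search k x le with x ≟ inhabited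
    ... | yes refl = here
    search zero    x le | no x≢ = contradiction (subst (_≤ 0) (depth-next x≢) le) (λ ())
    search (suc k) x le | no x≢ = step x≢ (search k (next x) (s≤s⁻¹ (subst (_≤ suc k) (depth-next x≢) le)))

  Child : Flag → Flag → Set
  Child f c = c ≢ inhabited × next c ≡ f

  Child? : ∀ f c → Dec (Child f c)
  Child? f c = ¬? (c ≟ inhabited) ×-dec (next c ≟ f)

  Desc-child : ∀ {f x} → Desc f x → x ≢ f → ∃[ c ] (Child f c × Desc c x)
  Desc-child here x≢f = contradiction refl x≢f
  Desc-child {f} {x} (step x≢ d) x≢f with next x ≟ f
  ... | yes eq = x , (x≢ , eq) , here
  ... | no neq = let c , ch , d′ = Desc-child d neq in c , ch , step x≢ d′

  -- The parts of the dual tree at a triangle and their cutset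

  module AtFlag (f : Flag) where

    Cutset : Cell 0F → Set
    Cutset v = (∃[ i ] ∃[ x ] (Extra i x × OnPath (anchor i x) v)) ⊎ (∃[ i ] OnPath (base-at i f) v)

    abstract
      Cutset? : ∀ v → Dec (Cutset v)
      Cutset? v = any? (λ i → any? λ x → Extra? i x ×-dec (v ≟ _)) ⊎-dec any? (λ i → v ≟ _)

    Cutset-up : ∀ {v} → v ≢ root → Cutset v → Cutset (up v)
    Cutset-up v≢root (inj₁ (i , x , e , on)) = inj₁ (i , x , e , OnPath-up (anchor i x) v≢root on)
    Cutset-up v≢root (inj₂ (i , on))         = inj₂ (i , OnPath-up (base-at i f) v≢root on)

    Extra-Cutset : ∀ {i x j} → j ≢ i → Extra i x → Cutset (base-at j x)
    Extra-Cutset {i} {x} {j} j≢i e = let y , e′ , eq = anchored i x j j≢i e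
      in inj₁ (i , y , e′ , subst (λ w → OnPath w (base-at j x)) (sym eq) (OnPath-refl _))

    flag-Cutset : ∀ j → Cutset (base-at j f)
    flag-Cutset j = inj₂ (j , OnPath-refl _)

    -- Outside the spanning tree, the subtree of `h` can be left only across an extra side or the
    -- parent side of `h`; the bases of the ends of both are in the cutset.
    Desc-cross : ∀ h → (h ≢ inhabited → ∀ j → j ≢ side-of h → Cutset (base-at j h)) →
                 ∀ i x → ¬ Tree i x → ∀ j → j ≢ i → ¬ Cutset (base-at j x) → Desc h x → Desc h (τ i x)
    Desc-cross h Zh i x ¬t j j≢i ¬Z d with Dual? i x
    ... | no ¬d                = contradiction (Extra-Cutset j≢i (¬t , ¬d)) ¬Z
    ... | yes (inj₂ (τx≢ , eq)) = step τx≢ (subst (Desc h)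
      (sym (trans (cong (λ k → τ k (τ i x)) eq) (τ-involutive i x))) d)
    ... | yes (inj₁ (x≢ , refl)) with d
    ...   | here     = contradiction (Zh x≢ j j≢i) ¬Z
    ...   | step _ e = e

    -- The part of the dual tree that hangs on `f` through its side of index `i`: the complement of
    -- the subtree of `f` if the side leads to the parent, the subtree of the neighbour if it leads
    -- to a child, and nothing if the side is not in the dual tree.
    Outside Inside Side : Fin 3 → Flag → Set
    Outside i x = (f ≢ inhabited × side-of f ≡ i) × ¬ Desc f x
    Inside i x  = (τ i f ≢ inhabited × side-of (τ i f) ≡ i) × Desc (τ i f) x
    Side i x    = Outside i x ⊎ Inside i x

    abstract
      Side? : ∀ i x → Dec (Side i x)
      Side? i x = (DualParent? i f ×-dec ¬? (Desc? f x)) ⊎-dec (DualParent? i (τ i f) ×-dec Desc? (τ i f) x)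

    Side-cover : ∀ x → x ≢ f → ∃[ i ] Side i x
    Side-cover x x≢f with Desc? f x
    ... | no ¬d = side-of f , inj₁ (((λ { refl → ¬d (Desc-root x) }) , refl) , ¬d)
    ... | yes d with Desc-child d x≢f
    ...   | c , (c≢ , refl) , d′ = side-of c , inj₂ (subst (λ y → (y ≢ inhabited × side-of y ≡ side-of c) × Desc y x)
      (sym (τ-involutive (side-of c) c)) ((c≢ , refl) , d′))

    -- The dual side that bounds a part is a side of `f`, so its ends are corners of `f`. An outside
    -- part is the complement of a subtree, so the crossing is made in reverse.
    Side-cross : ∀ k i x → ¬ Tree i x → ∀ j → j ≢ i → ¬ Cutset (base-at j x) → Side k x → Side k (τ i x)
    Side-cross k i x ¬t j j≢i ¬Z (inj₁ (fk , ¬d)) = inj₁ (fk , λ d → ¬d (subst (Desc f) (τ-involutive i x)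
      (Desc-cross f (λ _ j _ → flag-Cutset j) i (τ i x)
        (λ t → ¬t (subst (Tree i) (τ-involutive i x) (Tree-sym i t))) j j≢i (¬Z ∘ subst Cutset (base-τ j≢i x)) d)))
    Side-cross k i x ¬t j j≢i ¬Z (inj₂ ((c≢ , eq) , d)) = inj₂ ((c≢ , eq) ,
      Desc-cross (τ k f) (λ _ j j≢ → subst Cutset (sym (base-τ {k} {j} (λ { refl → j≢ (sym eq) }) f)) (flag-Cutset j))
        i x ¬t j j≢i ¬Z d)

    uncut : ∀ k i x → ¬ Tree i x → ∀ j → j ≢ i → ¬ Cutset (base-at j x) → does (Side? k x) ≡ does (Side? k (τ i x))
    uncut k i x ¬t j j≢i ¬Z = does-cong (Side? k x) (Side? k (τ i x)) (Side-cross k i x ¬t j j≢i ¬Z)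
      (λ s → subst (Side k) (τ-involutive i x) (Side-cross k i (τ i x)
        (λ t → ¬t (subst (Tree i) (τ-involutive i x) (Tree-sym i t))) j j≢i (¬Z ∘ subst Cutset (base-τ j≢i x)) s))

    module SideCut (k : Fin 3) = Cut (does ∘ Side? k) Cutset Cutset-up (uncut k)

    Side-const : ∀ k x y → cell 0F x ≡ cell 0F y → ¬ Cutset (cell 0F x) → Side k x → Side k y
    Side-const k x y eq ¬Z = does-transport (Side? k x) (Side? k y) (SideCut.constant-at k x y eq ¬Z)

    -- The side crossed by `τ 0F` ends at the barycentre of the edge, whose base is one of the two
    -- ends of the edge and hence not in the cutset.
    Side-edge : ∀ k x → ¬ Cutset (cell 0F x) → ¬ Cutset (cell 0F (τ 0F x)) → Side k x → Side k (τ 0F x)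
    Side-edge k x ¬Zx ¬Zτx = Side-cross k 0F x (λ ()) 1F (λ ()) ¬Zm
      where
      midpoint : ∀ {y} → EdgeOrbit x y → ¬ Cutset (cell 0F y)
      midpoint same   = ¬Zx
      midpoint end    = ¬Zτx
      midpoint side   = ¬Zx ∘ subst Cutset (cell-τ (λ ()) x)
      midpoint across = ¬Zτx ∘ subst Cutset (trans (cong (cell 0F) (τ₀τ₂-comm x)) (cell-τ (λ ()) (τ 0F x)))
      ¬Zm : ¬ Cutset (base-at 1F x)
      ¬Zm = midpoint (edgeOrbit (sym (cell-eFlag (cell 1F x))))

    -- `OnPath` with the distance of the vertex fixed to `ℓ`.
    hits : ℕ → Cell 0F → Vertex → ℕ
    hits ℓ w v = 𝟙 (vertex v ≟ climb (dist w ∸ ℓ) w)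

    hits-Extra : ℕ → Fin 3 → Flag → Vertex → ℕ
    hits-Extra ℓ i x v = 𝟙 (Extra? i x ×-dec (vertex v ≟ climb (dist (anchor i x) ∸ ℓ) (anchor i x)))

    -- A vertical path meets every layer at most once.
    sum-hits : ∀ ℓ w → sum (hits ℓ w) ≤ 1
    sum-hits ℓ w = sum-fibre≤1 vertex vertex-injective (climb (dist w ∸ ℓ) w)

    sum-hits-Extra : ∀ ℓ i x → sum (hits-Extra ℓ i x) ≤ 𝟙 (Extra? i x)
    sum-hits-Extra ℓ i x = sum-guarded (Extra? i x) (λ v → vertex v ≟ climb (dist (anchor i x) ∸ ℓ) (anchor i x)) (sum-hits ℓ (anchor i x))

    -- Incidences of vertices with paths are counted: at most one for each anchor of an extra side
    -- and one for each corner of `f`.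
    layer-bound : (p : Subset order) (ℓ : ℕ) → (∀ v → v ∈ p → dist (vertex v) ≡ ℓ × Cutset (vertex v)) →
                  ∣ p ∣ ≤ 2 * g + 3
    layer-bound p ℓ h = begin
      ∣ p ∣                                       ≤⟨ ∣∣≤sum p (λ v → extra v + flag v) hit ⟩
      sum (λ v → extra v + flag v)                ≡⟨ ∑-distrib-+ extra flag ⟩
      sum extra + sum flag                        ≤⟨ +-mono-≤ sum-extra sum-flag ⟩
      2 * g + 3                                   ∎
      where
      open ≤-Reasoning
      extra flag : Vertex → ℕ
      extra v = sum (λ i → sum (λ x → hits-Extra ℓ i x v))
      flag v  = sum (λ i → hits ℓ (base-at i f) v)
      hit : ∀ v → v ∈ p → 1 ≤ extra v + flag v
      hit v v∈p with h v v∈p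
      ... | refl , inj₁ (i , x , e , on) = begin
        1                                       ≡⟨ 𝟙-yes (Extra? i x ×-dec (vertex v ≟ _)) (e , on) ⟨
        hits-Extra ℓ i x v                      ≤⟨ term≤sum (λ x → hits-Extra ℓ i x v) x ⟩
        sum (λ x → hits-Extra ℓ i x v)          ≤⟨ term≤sum (λ i → sum (λ x → hits-Extra ℓ i x v)) i ⟩
        extra v                                 ≤⟨ m≤m+n (extra v) (flag v) ⟩
        extra v + flag v                        ∎
      ... | refl , inj₂ (i , on) = begin
        1                                       ≡⟨ 𝟙-yes (vertex v ≟ _) on ⟨
        hits ℓ (base-at i f) v                  ≤⟨ term≤sum (λ i → hits ℓ (base-at i f) v) i ⟩
        flag v                                  ≤⟨ m≤n+m (flag v) (extra v) ⟩
        extra v + flag v                        ∎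
      sum-flag : sum flag ≤ 3
      sum-flag = begin
        sum flag                                        ≡⟨ ∑-comm (λ v i → hits ℓ (base-at i f) v) ⟩
        sum {3} (λ i → sum (hits ℓ (base-at i f)))      ≤⟨ sum-mono-≤ {3} (λ i → sum-hits ℓ (base-at i f)) ⟩
        3                                               ∎
      sum-extra : sum extra ≤ 2 * g
      sum-extra = begin
        sum extra                                             ≡⟨ ∑-comm (λ v i → sum (λ x → hits-Extra ℓ i x v)) ⟩
        sum {3} (λ i → sum (λ v → sum (λ x → hits-Extra ℓ i x v)))
          ≤⟨ sum-mono-≤ {3} (λ i → ≤-trans (≤-reflexive (∑-comm (λ v x → hits-Extra ℓ i x v)))
               (sum-mono-≤ (sum-hits-Extra ℓ i))) ⟩
        sum {3} (λ i → # (Extra? i))                          ≡⟨ regroup (# (Extra? 0F)) (# (Extra? 1F)) (# (Extra? 2F)) ⟩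
        # (Extra? 0F) + # (Extra? 1F) + # (Extra? 2F)         ≤⟨ #Extra genus ⟩
        2 * g                                                 ∎
        where
        regroup : ∀ a b c → a + (b + (c + 0)) ≡ a + b + c
        regroup = solve-∀

  -- The balanced triangle and the separation

  module Balanced (S : Subset order) where

    -- An arbitrary flag stands for each vertex; by `Side-const` the choice is immaterial off the
    -- cutset.
    φ : Vertex → Flag
    φ v = rep 0F (vertex v)

    In? : {A : Flag → Set} → (∀ x → Dec (A x)) → ∀ v → Dec (v ∈ S × A (φ v))
    In? A? v = (v ∈? S) ×-dec A? (φ v)

    weight : {A : Flag → Set} → (∀ x → Dec (A x)) → ℕ
    weight A? = sum (λ v → 𝟙 (In? A? v))

    weight-mono : {A B : Flag → Set} (A? : ∀ x → Dec (A x)) (B? : ∀ x → Dec (B x)) →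
                  (∀ {x} → A x → B x) → weight A? ≤ weight B?
    weight-mono A? B? A⊆B = sum-mono-≤ λ v → 𝟙-mono (In? A? v) (In? B? v) (λ { (s , a) → s , A⊆B a })

    weight-disjoint : {A B : Flag → Set} (A? : ∀ x → Dec (A x)) (B? : ∀ x → Dec (B x)) →
                      (∀ {x} → A x → B x → ⊥) → weight A? + weight B? ≤ ∣ S ∣
    weight-disjoint A? B? A∩B = begin
      weight A? + weight B?                              ≡⟨ ∑-distrib-+ (𝟙 ∘ In? A?) (𝟙 ∘ In? B?) ⟨
      sum (λ v → 𝟙 (In? A? v) + 𝟙 (In? B? v))
        ≤⟨ sum-mono-≤ (λ v → 𝟙-+ (In? A? v) (In? B? v) (v ∈? S) (λ { (_ , a) (_ , b) → A∩B a b }) proj₁ proj₁) ⟩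
      sum (λ v → 𝟙 (v ∈? S))                             ≡⟨ sum-∈ S ⟩
      ∣ S ∣                                              ∎
      where open ≤-Reasoning

    Heavy : Flag → Set
    Heavy f = ∣ S ∣ ≤ 2 * weight (Desc? f)

    abstract
      Heavy? : ∀ f → Dec (Heavy f)
      Heavy? f = ∣ S ∣ ≤? 2 * weight (Desc? f)

    Heavy-root : Heavy inhabited
    Heavy-root = ≤-trans (≤-trans (≤-reflexive (sym (sum-∈ S)))
      (sum-mono-≤ (λ v → 𝟙-mono (v ∈? S) (In? (Desc? inhabited) v) (_, Desc-root _)))) (m≤m+n _ _)

    abstract
      deepest : ∃[ f ] (Heavy f × (∀ c → Child f c → ¬ Heavy c))
      deepest = search (suc #flags) inhabited Heavy-root (m≤n+m _ (depth inhabited))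
        where
        search : ∀ k f → Heavy f → #flags < depth f + k → ∃[ f ] (Heavy f × (∀ c → Child f c → ¬ Heavy c))
        search zero    f _ lt = contradiction (depth≤ f) (<⇒≱ (subst (#flags <_) (+-identityʳ _) lt))
        search (suc k) f h lt with any? (λ c → Child? f c ×-dec Heavy? c)
        ... | no ¬c                       = f , h , λ c ch hc → ¬c (c , ch , hc)
        ... | yes (c , (c≢ , refl) , hc)  = search k c hc (subst (#flags <_)
          (trans (+-suc (depth (next c)) k) (cong (_+ k) (sym (depth-next c≢)))) lt)

    f : Flag
    f = proj₁ deepest

    f-heavy : Heavy f
    f-heavy = proj₁ (proj₂ deepest)

    child-light : ∀ c → Child f c → 2 * weight (Desc? c) ≤ ∣ S ∣
    child-light c ch = <⇒≤ (≰⇒> (proj₂ (proj₂ deepest) c ch))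

    open AtFlag f

    W : Fin 3 → ℕ
    W i = weight (Side? i)

    -- An outside part avoids the heavy subtree of `f`, an inside part is the subtree of a child
    -- that is not heavy, and otherwise the part is empty.
    W-light : ∀ i → 2 * W i ≤ ∣ S ∣
    W-light i = light (DualParent? i f) (DualParent? i (τ i f))
      where
      open ≤-Reasoning
      w : ℕ
      w = weight (Desc? f)
      light : Dec (DualParent i f) → Dec (DualParent i (τ i f)) → 2 * W i ≤ ∣ S ∣
      light (yes fi) _ = begin
        2 * W i      ≡⟨ cong (W i +_) (+-identityʳ (W i)) ⟩
        W i + W i    ≤⟨ +-monoʳ-≤ (W i) W≤w ⟩
        W i + w      ≤⟨ disjoint ⟩
        ∣ S ∣        ∎
        where
        outside-only : ∀ {x} → Side i x → Desc f x → ⊥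
        outside-only (inj₁ (_ , ¬d)) d = ¬d d
        outside-only (inj₂ (ci , _)) _ = DualParent-once i f fi ci
        disjoint : W i + w ≤ ∣ S ∣
        disjoint = weight-disjoint (Side? i) (Desc? f) outside-only
        W≤w : W i ≤ w
        -- From `W i + w ≤ ∣ S ∣ ≤ 2 * w`.
        W≤w = +-cancelʳ-≤ w (W i) w (≤-trans disjoint (≤-trans f-heavy (≤-reflexive (cong (w +_) (+-identityʳ w)))))
      light (no ¬fi) (yes (c≢ , eq)) = ≤-trans
        (*-monoʳ-≤ 2 (weight-mono (Side? i) (Desc? (τ i f)) inside-only))
        (child-light (τ i f) (c≢ , trans (cong (λ j → τ j (τ i f)) eq) (τ-involutive i f)))
        where
        inside-only : ∀ {x} → Side i x → Desc (τ i f) x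
        inside-only (inj₁ (fi , _)) = contradiction fi ¬fi
        inside-only (inj₂ (_ , d))  = d
      light (no ¬fi) (no ¬ci) = subst (λ m → 2 * m ≤ ∣ S ∣) (sym empty) z≤n
        where
        none : ∀ {x} → ¬ Side i x
        none (inj₁ (fi , _)) = ¬fi fi
        none (inj₂ (ci , _)) = ¬ci ci
        empty : W i ≡ 0
        empty = trans (sum-cong-≗ (λ v → 𝟙-no (In? (Side? i) v) (none ∘ proj₂))) (sum-replicate-zero order)

    abstract
      heaviest : ∃[ j ] (∀ i → W i ≤ W j)
      heaviest = argmax W

    k : Fin 3
    k = proj₁ heaviest

    W-max : ∀ i → W i ≤ W k
    W-max = proj₂ heaviest

    Left Right : Vertex → Set
    Left v  = Cutset (vertex v) ⊎ Side k (φ v)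
    Right v = Cutset (vertex v) ⊎ ¬ Side k (φ v)

    abstract
      Left? : ∀ v → Dec (Left v)
      Left? v = Cutset? (vertex v) ⊎-dec Side? k (φ v)

    abstract
      Right? : ∀ v → Dec (Right v)
      Right? v = Cutset? (vertex v) ⊎-dec ¬? (Side? k (φ v))

    induced : Subset order → Subgraph G
    induced p = record
      { V      = p
      ; E      = λ u v → u ~ v × u ∈ p × v ∈ p
      ; E?     = λ u v → (u ~? v) ×-dec ((u ∈? p) ×-dec (v ∈? p))
      ; E-sym  = λ { (e , u∈ , v∈) → ~-sym e , v∈ , u∈ }
      ; E⊆~    = proj₁
      ; E-ends = proj₁ ∘ proj₂
      }

    -- Turn around `u` from `φ u` to a flag of the edge, pass along the edge, and turn around `v` to
    -- `φ v`; none of these leaves the part.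
    no-crossing : ∀ {u v} → u ~ v → ¬ Cutset (vertex u) → ¬ Cutset (vertex v) → Side k (φ u) → Side k (φ v)
    no-crossing {u} {v} u~v ¬Zu ¬Zv s with edge u~v
    ... | x , xu , xv = Side-const k (τ 0F x) (φ v) (trans xv (sym (cell-rep 0F (vertex v)))) ¬Zτx
      (Side-edge k x ¬Zx ¬Zτx
        (Side-const k (φ u) x (trans (cell-rep 0F (vertex u)) (sym xu)) (¬Zu ∘ subst Cutset (cell-rep 0F (vertex u))) s))
      where
      ¬Zx : ¬ Cutset (cell 0F x)
      ¬Zx = ¬Zu ∘ subst Cutset xu
      ¬Zτx : ¬ Cutset (cell 0F (τ 0F x))
      ¬Zτx = ¬Zv ∘ subst Cutset xv

    edge-side : ∀ {u v} → u ~ v → (Left u × Left v) ⊎ (Right u × Right v)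
    edge-side {u} {v} u~v with Cutset? (vertex u) | Cutset? (vertex v) | Side? k (φ u) | Side? k (φ v)
    ... | yes zu | yes zv | _      | _      = inj₁ (inj₁ zu , inj₁ zv)
    ... | yes zu | no _   | _      | yes sv = inj₁ (inj₁ zu , inj₂ sv)
    ... | yes zu | no _   | _      | no ¬sv = inj₂ (inj₁ zu , inj₂ ¬sv)
    ... | no _   | yes zv | yes su | _      = inj₁ (inj₂ su , inj₁ zv)
    ... | no _   | yes zv | no ¬su | _      = inj₂ (inj₂ ¬su , inj₁ zv)
    ... | no _   | no _   | yes su | yes sv = inj₁ (inj₂ su , inj₂ sv)
    ... | no _   | no _   | no ¬su | no ¬sv = inj₂ (inj₂ ¬su , inj₂ ¬sv)
    ... | no ¬zu | no ¬zv | yes su | no ¬sv = contradiction (no-crossing u~v ¬zu ¬zv su) ¬sv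
    ... | no ¬zu | no ¬zv | no ¬su | yes sv = contradiction (no-crossing (~-sym u~v) ¬zv ¬zu sv) ¬su

    separation : Separation G
    separation = record
      { G₁      = induced ⟪ Left? ⟫
      ; G₂      = induced ⟪ Right? ⟫
      ; V-cover = λ v → cover v (Side? k (φ v))
      ; E-cover = λ {u} {v} u~v → cover-edge u~v (edge-side u~v)
      }
      where
      cover : ∀ v → Dec (Side k (φ v)) → v ∈ ⟪ Left? ⟫ ⊎ v ∈ ⟪ Right? ⟫
      cover v (yes s) = inj₁ (∈⟪⟫⁺ Left? (inj₂ s))
      cover v (no ¬s) = inj₂ (∈⟪⟫⁺ Right? (inj₂ ¬s))
      cover-edge : ∀ {u v} → u ~ v → (Left u × Left v) ⊎ (Right u × Right v) →
                   (u ~ v × u ∈ ⟪ Left? ⟫ × v ∈ ⟪ Left? ⟫) ⊎ (u ~ v × u ∈ ⟪ Right? ⟫ × v ∈ ⟪ Right? ⟫)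
      cover-edge e (inj₁ (lu , lv)) = inj₁ (e , ∈⟪⟫⁺ Left? lu , ∈⟪⟫⁺ Left? lv)
      cover-edge e (inj₂ (ru , rv)) = inj₂ (e , ∈⟪⟫⁺ Right? ru , ∈⟪⟫⁺ Right? rv)

    width : ∀ i → ∣ layer i ∩ (⟪ Left? ⟫ ∩ ⟪ Right? ⟫) ∣ ≤ 2 * g + 3
    width i = layer-bound _ (toℕ i) on-path
      where
      both : ∀ {v} → Left v → Right v → Cutset (vertex v)
      both (inj₁ z) _         = z
      both (inj₂ _) (inj₁ z)  = z
      both (inj₂ s) (inj₂ ¬s) = contradiction s ¬s
      on-path : ∀ v → v ∈ layer i ∩ (⟪ Left? ⟫ ∩ ⟪ Right? ⟫) → dist (vertex v) ≡ toℕ i × Cutset (vertex v)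
      on-path v v∈ = let v∈i , v∈lr = x∈p∩q⁻ (layer i) _ v∈ ; v∈l , v∈r = x∈p∩q⁻ ⟪ Left? ⟫ ⟪ Right? ⟫ v∈lr in
        trans (sym (toℕ-layerOf v)) (cong toℕ (∈⟪⟫⁻ (λ w → layerOf w ≟ i) v∈i)) ,
        both (∈⟪⟫⁻ Left? v∈l) (∈⟪⟫⁻ Right? v∈r)

    left-light : 3 * ∣ (⟪ Left? ⟫ ─ ⟪ Right? ⟫) ∩ S ∣ ≤ 2 * ∣ S ∣
    left-light = begin
      3 * ∣ (⟪ Left? ⟫ ─ ⟪ Right? ⟫) ∩ S ∣   ≤⟨ *-monoʳ-≤ 3 (∣∣≤sum _ (𝟙 ∘ In? (Side? k)) in-side) ⟩
      3 * W k                                 ≤⟨ m≤m+n (3 * W k) (W k) ⟩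
      3 * W k + W k                           ≡⟨ four (W k) ⟩
      2 * (2 * W k)                           ≤⟨ *-monoʳ-≤ 2 (W-light k) ⟩
      2 * ∣ S ∣                               ∎
      where
      open ≤-Reasoning
      four : ∀ w → 3 * w + w ≡ 2 * (2 * w)
      four = solve-∀
      in-side : ∀ v → v ∈ (⟪ Left? ⟫ ─ ⟪ Right? ⟫) ∩ S → 1 ≤ 𝟙 (In? (Side? k) v)
      in-side v v∈ with x∈p∩q⁻ (⟪ Left? ⟫ ─ ⟪ Right? ⟫) S v∈
      ... | v∈l─r , v∈S with ∈⟪⟫⁻ Left? (p─q⊆p ⟪ Left? ⟫ ⟪ Right? ⟫ v∈l─r)
      ...   | inj₁ z = contradiction (∈⟪⟫⁺ Right? (inj₁ z)) (─-∉ ⟪ Left? ⟫ ⟪ Right? ⟫ v∈l─r)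
      ...   | inj₂ s = ≤-reflexive (sym (𝟙-yes (In? (Side? k) v) (v∈S , s)))

    abstract
      Rest? : ∀ v → Dec ((¬ Cutset (vertex v)) × v ∈ S × ¬ Side k (φ v))
      Rest? v = ¬? (Cutset? (vertex v)) ×-dec In? (λ x → ¬? (Side? k x)) v

    -- The rest is at most ∣ S ∣ − W k and at most the sum of the two smaller sides, hence at most 2 W k.
    right-light : 3 * ∣ (⟪ Right? ⟫ ─ ⟪ Left? ⟫) ∩ S ∣ ≤ 2 * ∣ S ∣
    right-light = ≤-trans (*-monoʳ-≤ 3 (∣∣≤sum _ (𝟙 ∘ Rest?) in-rest)) (two-thirds (sum (𝟙 ∘ Rest?)) (W k) ∣ S ∣ bound₁ bound₂)
      where
      open ≤-Reasoning
      in-rest : ∀ v → v ∈ (⟪ Right? ⟫ ─ ⟪ Left? ⟫) ∩ S → 1 ≤ 𝟙 (Rest? v)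
      in-rest v v∈ = ≤-reflexive (sym (𝟙-yes (Rest? v)
        ((v∉l ∘ ∈⟪⟫⁺ Left? ∘ inj₁) , proj₂ split , (v∉l ∘ ∈⟪⟫⁺ Left? ∘ inj₂))))
        where
        split : v ∈ ⟪ Right? ⟫ ─ ⟪ Left? ⟫ × v ∈ S
        split = x∈p∩q⁻ (⟪ Right? ⟫ ─ ⟪ Left? ⟫) S v∈
        v∉l : v ∉ ⟪ Left? ⟫
        v∉l = ─-∉ ⟪ Right? ⟫ ⟪ Left? ⟫ (proj₁ split)
      bound₁ : sum (𝟙 ∘ Rest?) + W k ≤ ∣ S ∣
      bound₁ = ≤-trans (+-monoˡ-≤ (W k) (sum-mono-≤ (λ v → 𝟙-mono (Rest? v) (In? (λ x → ¬? (Side? k x)) v) proj₂)))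
        (weight-disjoint (λ x → ¬? (Side? k x)) (Side? k) λ ¬s s → ¬s s)
      pointwise : ∀ v → 𝟙 (Rest? v) + 𝟙 (In? (Side? k) v) ≤ sum {3} (λ i → 𝟙 (In? (Side? i) v))
      pointwise v with Rest? v
      ... | no _ = term≤sum (λ i → 𝟙 (In? (Side? i) v)) k
      -- The 0-cell of `f` is in the cutset, so `φ v` is not `f` and lies in some part.
      ... | yes (¬z , v∈S , ¬s) with Side-cover (φ v)
        (λ eq → ¬z (subst Cutset (trans (cong (cell 0F) (sym eq)) (cell-rep 0F (vertex v))) (flag-Cutset 0F)))
      ...   | i , s = begin
        suc (𝟙 (In? (Side? k) v))               ≡⟨ cong suc (𝟙-no (In? (Side? k) v) (¬s ∘ proj₂)) ⟩
        1                                       ≡⟨ 𝟙-yes (In? (Side? i) v) (v∈S , s) ⟨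
        𝟙 (In? (Side? i) v)                     ≤⟨ term≤sum (λ i → 𝟙 (In? (Side? i) v)) i ⟩
        sum {3} (λ i → 𝟙 (In? (Side? i) v))     ∎
      bound₂ : sum (𝟙 ∘ Rest?) + W k ≤ 3 * W k
      bound₂ = begin
        sum (𝟙 ∘ Rest?) + W k                                    ≡⟨ ∑-distrib-+ (𝟙 ∘ Rest?) (𝟙 ∘ In? (Side? k)) ⟨
        sum (λ v → 𝟙 (Rest? v) + 𝟙 (In? (Side? k) v))            ≤⟨ sum-mono-≤ pointwise ⟩
        sum (λ v → sum {3} (λ i → 𝟙 (In? (Side? i) v)))          ≡⟨ ∑-comm (λ v i → 𝟙 (In? (Side? i) v)) ⟩
        sum {3} W                                                ≤⟨ sum-mono-≤ {3} W-max ⟩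
        sum {3} (λ _ → W k)                                      ≡⟨⟩
        3 * W k                                                  ∎
      -- Twice the first bound plus the second, with `3 * w` cancelled.
      two-thirds : ∀ r w s → r + w ≤ s → r + w ≤ 3 * w → 3 * r ≤ 2 * s
      two-thirds r w s b₁ b₂ = +-cancelʳ-≤ (3 * w) (3 * r) (2 * s) (begin
        3 * r + 3 * w              ≡⟨ spread r w ⟩
        2 * (r + w) + (r + w)      ≤⟨ +-mono-≤ (*-monoʳ-≤ 2 b₁) b₂ ⟩
        2 * s + 3 * w              ∎)
        where
        spread : ∀ r w → 3 * r + 3 * w ≡ 2 * (r + w) + (r + w)
        spread = solve-∀

theorem13 : (g : ℕ) (G : Graph) → HasEulerGenus G g → AdmitsLayeredSeparations G (2 * g + 3)
theorem13 g G ((M , emb , genus) , _) = layering , λ S →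
  let open Balanced S in separation , width , left-light , right-light
  where open Separator M genus emb
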